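{- Fix integers $t\ge 2$ and $s_1,s_2,\dots,s_t\ge 3$, and for $1\le i\le t$ set $m_i=R(s_1,\dots,s_{i-1},s_i-1,s_{i+1},\dots,s_t)$. Suppose $m_1\ge m_j$ for all $j\ge 2$. Then for every positive integer $r$, $$R^{\mathrm{KG}}_r(s_1,\dots,s_t)\le (m_1+1)r+\sum_{i=2}^{t}(m_i-1).$$
   Context: The multicolor Ramsey number $R(s_1,\dots,s_t)$ is the minimum $n$ such that in every $t$-coloring of the edges of $K_n$ there is, for some $i\in[t]$, a clique $K_{s_i}$ all of whose edges have color $i$. The Kneser graph $\mathrm{KG}(n,r)$ has vertex set the $r$-element subsets of $[n]=\{1,\dots,n\}$, with two sets adjacent iff they are disjoint. The multicolor $r$-Kneser Ramsey number $R^{\mathrm{KG}}_r(s_1,\dots,s_t)$ is the minimum $n$ such that in every $t$-coloring of the edges of $\mathrm{KG}(n,r)$ there is, for some $i\in[t]$, a set of $s_i$ pairwise adjacent vertices all of whose connecting edges have color $i$. -}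

module Defs where

open import Data.Nat using (ℕ; zero; suc; _+_; _∸_)
open import Data.Fin using (Fin; zero; suc; _≟_)
open import Data.Fin.Subset using (Subset; _∩_; ∣_∣) renaming (⊥ to ∅)
open import Data.Product using (Σ; ∃; _×_)
open import Relation.Nullary using (¬_; yes; no)
open import Relation.Binary.PropositionalEquality using (_≡_)
open import Function.Definitions using (Injective)

∑ : (n : ℕ) → (Fin n → ℕ) → ℕ
∑ zero f = 0
∑ (suc n) f = f zero + ∑ n (λ j → f (suc j))

decAt : {t : ℕ} → (Fin t → ℕ) → Fin t → (Fin t → ℕ)
decAt s i j with j ≟ i
... | yes _ = s j ∸ 1
... | no  _ = s j

-- A t-colouring of the edges of K_n: a symmetric map on pairs of vertices
-- (values on the diagonal are irrelevant).
SymColouring : (X : Set) (t : ℕ) → (X → X → Fin t) → Set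
SymColouring X t c = ∀ x y → c x y ≡ c y x

MonoClique : {n t : ℕ} → (Fin n → Fin n → Fin t) → Fin t → ℕ → Set
MonoClique {n} c i k =
  Σ (Fin k → Fin n) λ f → Injective _≡_ _≡_ f ×
    (∀ a b → ¬ a ≡ b → c (f a) (f b) ≡ i)

RamseyProp : (t : ℕ) → (Fin t → ℕ) → ℕ → Set
RamseyProp t s n =
  (c : Fin n → Fin n → Fin t) → SymColouring (Fin n) t c →
  ∃ λ i → MonoClique c i (s i)

IsRamseyNumber : (t : ℕ) → (Fin t → ℕ) → ℕ → Set
IsRamseyNumber t s m = RamseyProp t s m × (∀ k → Data.Nat._<_ k m → ¬ RamseyProp t s k)

-- Kneser graph KG(n,r): vertices are r-subsets of [n], adjacency = disjointness
Disjoint : {n : ℕ} → Subset n → Subset n → Set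
Disjoint A B = A ∩ B ≡ ∅

KneserMonoClique : {n t : ℕ} → (r : ℕ) → (Subset n → Subset n → Fin t) → Fin t → ℕ → Set
KneserMonoClique {n} r c i k =
  Σ (Fin k → Subset n) λ f → Injective _≡_ _≡_ f ×
    (∀ a → ∣ f a ∣ ≡ r) ×
    (∀ a b → ¬ a ≡ b → Disjoint (f a) (f b) × c (f a) (f b) ≡ i)

-- every t-colouring of the edges of KG(n,r) has, for some i, a colour-i clique of size s_i
-- (colourings are given as symmetric maps on all pairs of subsets; only the values on
--  edges of KG(n,r) matter)
KneserRamseyProp : (r t : ℕ) → (Fin t → ℕ) → ℕ → Set
KneserRamseyProp r t s n =
  (c : Subset n → Subset n → Fin t) → SymColouring (Subset n) t c →
  ∃ λ i → KneserMonoClique r c i (s i)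

KneserRamseyLE : (r t : ℕ) → (Fin t → ℕ) → ℕ → Set
KneserRamseyLE r t s B = ∃ λ n → Data.Nat._≤_ n B × KneserRamseyProp r t s n

{-# OPTIONS --safe #-}

-- Fix a vertex A.  Each other vertex disjoint from A is coloured by its edge to A, so it suffices to find,
-- among the r-subsets of the remaining m₁ r + ∑_{i ≥ 2} (mᵢ - 1) points, mᵢ pairwise disjoint ones joined to A
-- in some colour i: the Ramsey property of mᵢ then gives a clique, to which A is added if its colour is i.
-- Such a matching is provided by the Alon–Frankl–Lovász theorem on Kneser hypergraphs.  That theorem for unequal
-- mᵢ reduces to the case where all are equal to k (add points whose sets get a fixed colour), and then to k prime
-- (multiplicativity in k).  For a prime p it follows from a ℤ/p-Tucker lemma: partial functions X from the points
-- to ℤ/p are given the level min(|X|, p(r - 1)) plus, for each colour, the number of ω ∈ ℤ/p such that X⁻¹(ω)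
-- contains an r-set of that colour.  If no colour has a p-matching, the levels are too few
-- for the equivariant labelling by ℤ/p that they carry.
module Submission where

open import Defs
open import Data.Nat using (ℕ; suc; _+_; _*_; _∸_; _≤_)
open import Data.Fin using (Fin; zero; suc)
open import Data.Bool as Bool using (Bool; true; false; _∧_; if_then_else_)
open import Data.Fin using (toℕ; fromℕ; fromℕ<; inject₁; inject≤; punchIn; remQuot; combine)
import Data.Fin.Properties as Fin
open import Data.Fin.Subset using (Subset; _∈_; _⊆_; _∩_; ∁; ⊥; ⊤; ∣_∣)
open import Data.Fin.Subset.Properties
open import Data.Integer as ℤ using (ℤ; 0ℤ; 1ℤ)
  renaming (_+_ to _+ᶻ_; _-_ to _-ᶻ_; _*_ to _*ᶻ_)
import Data.Integer.Properties as ℤ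
open import Data.Integer.Tactic.RingSolver using (solve-∀)
open import Data.List using ([]; _∷_)
open import Data.List.Relation.Unary.All using (All; []; _∷_)
open import Data.Maybe as Maybe using (Maybe; just; nothing)
open import Data.Nat using (zero; _<_; z≤n; s≤s; _⊓_; NonZero; nonTrivial⇒n>1; parity)
open import Data.Nat.Coprimality using (coprime-Bézout; prime⇒coprime)
open import Data.Nat.DivMod using (_/_; _%_; m%n<n; m<n⇒m%n≡m; [m+kn]%n≡m%n; m≡m%n+[m/n]*n)
open import Data.Nat.GCD using (module Bézout)
open import Data.Nat.ListAction using (product)
open import Data.Nat.Primality using (Prime; prime⇒nonTrivial; ¬prime[0])
open import Data.Nat.Primality.Factorisation using (PrimeFactorisation; factorise)
open import Data.Nat.Properties as ℕ using (suc-injective)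
open import Data.Nat.Solver using (module +-*-Solver)
open import Data.Parity.Base using (Parity; 0ℙ; 1ℙ; _⁻¹)
open import Data.Parity.Properties using (suc-homo-⁻¹)
open import Data.Product using (Σ; ∃; ∃₂; _×_; _,_; proj₁; proj₂; uncurry)
open import Data.Sum using (_⊎_; inj₁; inj₂)
open import Data.Vec as Vec using (Vec; []; _∷_)
open import Data.Vec.Properties using (∷-injectiveˡ; ∷-injectiveʳ)
open import Function using (_∘_; id)
open import Function.Bundles using (mk⇔)
open import Relation.Binary.PropositionalEquality
open import Relation.Nullary using (¬_; Dec; yes; no; does; contradiction)
open import Relation.Nullary.Decidable using (map′; _×-dec_; _⊎-dec_; does-⇔)

module ℕSolver = +-*-Solver

-- A ℤ/p-Tucker lemma

-- This is subtraction of 1 in ℤ/p, so that from the label `a` an orbit reaches `zero` after exactly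
-- `toℕ a` turns.
turn : ∀ {q} → Fin (suc q) → Fin (suc q)
turn {q} zero = fromℕ q
turn (suc i) = inject₁ i

turn^ : ∀ {q} → ℕ → Fin (suc q) → Fin (suc q)
turn^ zero    a = a
turn^ (suc k) a = turn^ k (turn a)

turn^-+ : ∀ {q} j k (a : Fin (suc q)) → turn^ (j + k) a ≡ turn^ k (turn^ j a)
turn^-+ zero    k a = refl
turn^-+ (suc j) k a = turn^-+ j k (turn a)

turn^-descends : ∀ {q} j (a b : Fin (suc q)) → toℕ a ≡ j + toℕ b → turn^ j a ≡ b
turn^-descends zero    a       b eq = Fin.toℕ-injective eq
turn^-descends (suc j) (suc i) b eq =
  turn^-descends j (inject₁ i) b (trans (Fin.toℕ-inject₁ i) (suc-injective eq))

-- The orbit of `a` descends to `zero`, wraps round to `fromℕ q` and descends again to `a`.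
turn^-period : ∀ {q} (a : Fin (suc q)) → turn^ (suc q) a ≡ a
turn^-period {q} a = begin
  turn^ (suc q) a                              ≡⟨ cong (λ m → turn^ m a) split ⟨
  turn^ (toℕ a + suc (q ∸ toℕ a)) a            ≡⟨ turn^-+ (toℕ a) _ a ⟩
  turn^ (suc (q ∸ toℕ a)) (turn^ (toℕ a) a)    ≡⟨ cong (turn^ (suc (q ∸ toℕ a))) (turn^-descends (toℕ a) a zero (sym (ℕ.+-identityʳ _))) ⟩
  turn^ (q ∸ toℕ a) (fromℕ q)                  ≡⟨ turn^-descends (q ∸ toℕ a) (fromℕ q) a (trans (Fin.toℕ-fromℕ q) (sym (ℕ.m∸n+n≡m a≤q))) ⟩
  a                                            ∎
  where
  open ≡-Reasoning
  a≤q : toℕ a ≤ q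
  a≤q = ℕ.≤-pred (Fin.toℕ<n a)
  split : toℕ a + suc (q ∸ toℕ a) ≡ suc q
  split = trans (ℕ.+-suc _ _) (cong suc (ℕ.m+[n∸m]≡n a≤q))

-- These are the faces of the n-fold join of the discrete space ℤ/p, the empty face included; `size`
-- is the dimension plus one.
Cell : ℕ → ℕ → Set
Cell p n = Vec (Maybe (Fin p)) n

size : ∀ {p n} → Cell p n → ℕ
size []            = 0
size (nothing ∷ X) = size X
size (just _  ∷ X) = suc (size X)

empty : ∀ {p} n → Cell p n
empty n = Vec.replicate n nothing

size-empty : ∀ {p} n → size (empty {p} n) ≡ 0
size-empty zero    = refl
size-empty (suc n) = size-empty n

rot : ∀ {q n} → Cell (suc q) n → Cell (suc q) n
rot = Vec.map (Maybe.map turn)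

infix 4 _⋖_

data _⋖_ {p : ℕ} : ∀ {n} → Cell p n → Cell p n → Set where
  here  : ∀ {n a} {X : Cell p n} → nothing ∷ X ⋖ just a ∷ X
  there : ∀ {n b} {Y X : Cell p n} → Y ⋖ X → b ∷ Y ⋖ b ∷ X

size-⋖ : ∀ {p n} {Y X : Cell p n} → Y ⋖ X → size X ≡ suc (size Y)
size-⋖ here = refl
size-⋖ (there {b = nothing} Y⋖X) = size-⋖ Y⋖X
size-⋖ (there {b = just _}  Y⋖X) = cong suc (size-⋖ Y⋖X)

size-rot : ∀ {q n} (X : Cell (suc q) n) → size (rot X) ≡ size X
size-rot []            = refl
size-rot (nothing ∷ X) = size-rot X
size-rot (just _ ∷ X)  = cong suc (size-rot X)

private
  add-sub : ∀ a b c d → (a -ᶻ b) +ᶻ (c -ᶻ d) ≡ (a +ᶻ c) -ᶻ (b +ᶻ d)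
  add-sub = solve-∀

  sub-add : ∀ a b c d → (a +ᶻ b) -ᶻ (c +ᶻ d) ≡ (a -ᶻ c) +ᶻ (b -ᶻ d)
  sub-add = solve-∀

  sub-sub : ∀ a b c d → (a -ᶻ b) -ᶻ (c -ᶻ d) ≡ (a -ᶻ c) -ᶻ (b -ᶻ d)
  sub-sub = solve-∀

  x-x≡0 : ∀ x → x -ᶻ x ≡ 0ℤ
  x-x≡0 = solve-∀

evenOrOdd : ∀ π → π ≡ 0ℙ ⊎ π ≡ 1ℙ
evenOrOdd 0ℙ = inj₁ refl
evenOrOdd 1ℙ = inj₂ refl

-- Cochains on the join and equivariant chain maps

module Cochains (q : ℕ) where

  Cochain : ℕ → Set
  Cochain n = Cell (suc q) n → ℤ

  rot^ : ∀ {n} → ℕ → Cell (suc q) n → Cell (suc q) n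
  rot^ zero    X = X
  rot^ (suc k) X = rot^ k (rot X)

  rot^-period : ∀ {n} (X : Cell (suc q) n) → rot^ (suc q) X ≡ X
  rot^-period X = go (suc q) X turn^-period
    where
    rot^-just : ∀ {n} k a (X : Cell (suc q) n) → rot^ k (just a ∷ X) ≡ just (turn^ k a) ∷ rot^ k X
    rot^-just zero    a X = refl
    rot^-just (suc k) a X = rot^-just k (turn a) (rot X)
    rot^-nothing : ∀ {n} k (X : Cell (suc q) n) → rot^ k (nothing ∷ X) ≡ nothing ∷ rot^ k X
    rot^-nothing zero    X = refl
    rot^-nothing (suc k) X = rot^-nothing k (rot X)
    rot^-[] : ∀ k → rot^ k [] ≡ []
    rot^-[] zero    = refl
    rot^-[] (suc k) = rot^-[] k
    go : ∀ {n} k (X : Cell (suc q) n) → (∀ (a : Fin (suc q)) → turn^ k a ≡ a) → rot^ k X ≡ X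
    go k []            h = rot^-[] k
    go k (nothing ∷ X) h = trans (rot^-nothing k X) (cong (nothing ∷_) (go k X h))
    go k (just a ∷ X)  h = trans (rot^-just k a X) (cong₂ (λ b Y → just b ∷ Y) (h a) (go k X h))

  -- The augmented simplicial coboundary: deleting a filled entry carries the sign (-1)^j, where j
  -- filled entries precede it.
  δ : ∀ {n} → Cochain n → Cochain n
  δ φ []            = 0ℤ
  δ φ (nothing ∷ X) = δ (φ ∘ (nothing ∷_)) X
  δ φ (just a ∷ X)  = φ (nothing ∷ X) -ᶻ δ (φ ∘ (just a ∷_)) X

  -- The length is left free because `fill` uses incomplete orbit sums; the norm is the case
  -- `suc q`.
  orbitSum : ∀ {n} → ℕ → Cochain n → Cochain n
  orbitSum zero    φ X = 0ℤ
  orbitSum (suc m) φ X = φ X +ᶻ orbitSum m φ (rot X)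

  -- The differentials of the periodic resolution of ℤ over ℤ[ℤ/p], transposed to cochains.
  D : ∀ {n} → Parity → Cochain n → Cochain n
  D 0ℙ φ X = φ X -ᶻ φ (rot X)
  D 1ℙ φ X = orbitSum (suc q) φ X

  δ-cong : ∀ {n} {φ ψ : Cochain n} X → (∀ {Y} → Y ⋖ X → φ Y ≡ ψ Y) → δ φ X ≡ δ ψ X
  δ-cong []            h = refl
  δ-cong (nothing ∷ X) h = δ-cong X (h ∘ there)
  δ-cong (just a ∷ X)  h = cong₂ _-ᶻ_ (h here) (δ-cong X (h ∘ there))

  δ-0 : ∀ {n} (X : Cell (suc q) n) → δ (λ _ → 0ℤ) X ≡ 0ℤ
  δ-0 []            = refl
  δ-0 (nothing ∷ X) = δ-0 X
  δ-0 (just a ∷ X)  = cong (0ℤ -ᶻ_) (δ-0 X)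

  δ-+ : ∀ {n} (φ ψ : Cochain n) X → δ (λ Y → φ Y +ᶻ ψ Y) X ≡ δ φ X +ᶻ δ ψ X
  δ-+ φ ψ []            = refl
  δ-+ φ ψ (nothing ∷ X) = δ-+ _ _ X
  δ-+ φ ψ (just a ∷ X)  = trans (cong (φ (nothing ∷ X) +ᶻ ψ (nothing ∷ X) -ᶻ_) (δ-+ _ _ X))
                                (sub-add (φ (nothing ∷ X)) (ψ (nothing ∷ X)) _ _)

  δ-sub : ∀ {n} (φ ψ : Cochain n) X → δ (λ Y → φ Y -ᶻ ψ Y) X ≡ δ φ X -ᶻ δ ψ X
  δ-sub φ ψ []            = refl
  δ-sub φ ψ (nothing ∷ X) = δ-sub _ _ X
  δ-sub φ ψ (just a ∷ X)  = trans (cong (φ (nothing ∷ X) -ᶻ ψ (nothing ∷ X) -ᶻ_) (δ-sub _ _ X))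
                                (sub-sub (φ (nothing ∷ X)) (ψ (nothing ∷ X)) _ _)

  δ-rot : ∀ {n} (φ : Cochain n) X → δ (φ ∘ rot) X ≡ δ φ (rot X)
  δ-rot φ []            = refl
  δ-rot φ (nothing ∷ X) = δ-rot _ X
  δ-rot φ (just a ∷ X)  = cong (φ (nothing ∷ rot X) -ᶻ_) (δ-rot (φ ∘ (just (turn a) ∷_)) X)

  δ-orbitSum : ∀ {n} m (φ : Cochain n) X → δ (orbitSum m φ) X ≡ orbitSum m (δ φ) X
  δ-orbitSum zero    φ X = δ-0 X
  δ-orbitSum (suc m) φ X =
    trans (δ-+ φ _ X) (cong (δ φ X +ᶻ_) (trans (δ-rot _ X) (δ-orbitSum m φ (rot X))))

  δ-D : ∀ {n} π (φ : Cochain n) X → δ (D π φ) X ≡ D π (δ φ) X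
  δ-D 0ℙ φ X = trans (δ-sub φ _ X) (cong (δ φ X -ᶻ_) (δ-rot φ X))
  δ-D 1ℙ φ X = δ-orbitSum (suc q) φ X

  δδ≡0 : ∀ {n} (φ : Cochain n) X → δ (δ φ) X ≡ 0ℤ
  δδ≡0 φ []            = refl
  δδ≡0 φ (nothing ∷ X) = δδ≡0 (φ ∘ (nothing ∷_)) X
  δδ≡0 φ (just a ∷ X)  = begin
    δ φ₀ X -ᶻ δ (λ Y → φ₀ Y -ᶻ δ φ₁ Y) X    ≡⟨ cong (δ φ₀ X -ᶻ_) (δ-sub φ₀ (δ φ₁) X) ⟩
    δ φ₀ X -ᶻ (δ φ₀ X -ᶻ δ (δ φ₁) X)        ≡⟨ cong (λ z → δ φ₀ X -ᶻ (δ φ₀ X -ᶻ z)) (δδ≡0 φ₁ X) ⟩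
    δ φ₀ X -ᶻ (δ φ₀ X -ᶻ 0ℤ)                ≡⟨ cancel (δ φ₀ X) ⟩
    0ℤ                                        ∎
    where
    open ≡-Reasoning
    φ₀ = φ ∘ (nothing ∷_)
    φ₁ = φ ∘ (just a ∷_)
    cancel : ∀ x → x -ᶻ (x -ᶻ 0ℤ) ≡ 0ℤ
    cancel = solve-∀

  orbitSum-cong : ∀ {n} m {φ ψ : Cochain n} X → (∀ j → φ (rot^ j X) ≡ ψ (rot^ j X)) →
                  orbitSum m φ X ≡ orbitSum m ψ X
  orbitSum-cong zero    X h = refl
  orbitSum-cong (suc m) X h = cong₂ _+ᶻ_ (h 0) (orbitSum-cong m (rot X) (h ∘ suc))

  orbitSum-0 : ∀ {n} m (X : Cell (suc q) n) → orbitSum m (λ _ → 0ℤ) X ≡ 0ℤ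
  orbitSum-0 zero    X = refl
  orbitSum-0 (suc m) X = cong (0ℤ +ᶻ_) (orbitSum-0 m (rot X))

  orbitSum-sub : ∀ {n} m (φ ψ : Cochain n) X →
               orbitSum m (λ Y → φ Y -ᶻ ψ Y) X ≡ orbitSum m φ X -ᶻ orbitSum m ψ X
  orbitSum-sub zero    φ ψ X = refl
  orbitSum-sub (suc m) φ ψ X = trans (cong (φ X -ᶻ ψ X +ᶻ_) (orbitSum-sub m φ ψ (rot X))) (add-sub (φ X) (ψ X) _ _)

  orbitSum-rot : ∀ {n} m (φ : Cochain n) X → orbitSum m φ (rot X) ≡ orbitSum m (φ ∘ rot) X
  orbitSum-rot zero    φ X = refl
  orbitSum-rot (suc m) φ X = cong (φ (rot X) +ᶻ_) (orbitSum-rot m φ (rot X))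

  orbitSum-nothing : ∀ {n} m (φ : Cochain (suc n)) X →
                     orbitSum m φ (nothing ∷ X) ≡ orbitSum m (φ ∘ (nothing ∷_)) X
  orbitSum-nothing zero    φ X = refl
  orbitSum-nothing (suc m) φ X = cong (φ (nothing ∷ X) +ᶻ_) (orbitSum-nothing m φ (rot X))

  orbitSum-snoc : ∀ {n} m (φ : Cochain n) X →
                  orbitSum (suc m) φ X ≡ orbitSum m φ X +ᶻ φ (rot^ m X)
  orbitSum-snoc zero    φ X = ℤ.+-comm (φ X) 0ℤ
  orbitSum-snoc (suc m) φ X =
    trans (cong (φ X +ᶻ_) (orbitSum-snoc m φ (rot X))) (sym (ℤ.+-assoc (φ X) _ _))

  orbitSum-telescope : ∀ {n} m (φ : Cochain n) X →
                       orbitSum m (D 0ℙ φ) X ≡ φ X -ᶻ φ (rot^ m X)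
  orbitSum-telescope zero    φ X = sym (x-x≡0 (φ X))
  orbitSum-telescope (suc m) φ X =
    trans (cong (φ X -ᶻ φ (rot X) +ᶻ_) (orbitSum-telescope m φ (rot X))) (join (φ X) (φ (rot X)) _)
    where
    join : ∀ a b c → (a -ᶻ b) +ᶻ (b -ᶻ c) ≡ a -ᶻ c
    join = solve-∀

  D-cong : ∀ {n} π {φ ψ : Cochain n} X → (∀ j → φ (rot^ j X) ≡ ψ (rot^ j X)) → D π φ X ≡ D π ψ X
  D-cong 0ℙ X h = cong₂ _-ᶻ_ (h 0) (h 1)
  D-cong 1ℙ {φ} {ψ} X h = orbitSum-cong (suc q) {φ} {ψ} X h

  D-0 : ∀ {n} π (X : Cell (suc q) n) → D π (λ _ → 0ℤ) X ≡ 0ℤ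
  D-0 0ℙ X = refl
  D-0 1ℙ X = orbitSum-0 (suc q) X

  D-sub : ∀ {n} π (φ ψ : Cochain n) X → D π (λ Y → φ Y -ᶻ ψ Y) X ≡ D π φ X -ᶻ D π ψ X
  D-sub 0ℙ φ ψ X = sub-sub (φ X) (ψ X) _ _
  D-sub 1ℙ φ ψ X = orbitSum-sub (suc q) φ ψ X

  D-rot : ∀ {n} π (φ : Cochain n) X → D π φ (rot X) ≡ D π (φ ∘ rot) X
  D-rot 0ℙ φ X = refl
  D-rot 1ℙ φ X = orbitSum-rot (suc q) φ X

  D-nothing : ∀ {n} π (φ : Cochain (suc n)) X → D π φ (nothing ∷ X) ≡ D π (φ ∘ (nothing ∷_)) X
  D-nothing 0ℙ φ X = refl
  D-nothing 1ℙ φ X = orbitSum-nothing (suc q) φ X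

  -- Both composites vanish because an orbit closes up after p steps: one telescopes, the other
  -- moves the first summand to the end.
  DD≡0 : ∀ {n} π (φ : Cochain n) X → D (π ⁻¹) (D π φ) X ≡ 0ℤ
  DD≡0 0ℙ φ X = begin
    orbitSum (suc q) (D 0ℙ φ) X     ≡⟨ orbitSum-telescope (suc q) φ X ⟩
    φ X -ᶻ φ (rot^ (suc q) X)      ≡⟨ cong (λ Y → φ X -ᶻ φ Y) (rot^-period X) ⟩
    φ X -ᶻ φ X                     ≡⟨ x-x≡0 (φ X) ⟩
    0ℤ                              ∎
    where open ≡-Reasoning
  DD≡0 1ℙ φ X = begin
    (φ X +ᶻ s) -ᶻ orbitSum (suc q) φ (rot X)       ≡⟨ cong ((φ X +ᶻ s) -ᶻ_) (orbitSum-snoc q φ (rot X)) ⟩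
    (φ X +ᶻ s) -ᶻ (s +ᶻ φ (rot^ (suc q) X))       ≡⟨ cong (λ Y → (φ X +ᶻ s) -ᶻ (s +ᶻ φ Y)) (rot^-period X) ⟩
    (φ X +ᶻ s) -ᶻ (s +ᶻ φ X)                      ≡⟨ cancel (φ X) s ⟩
    0ℤ                                               ∎
    where
    open ≡-Reasoning
    s = orbitSum q φ (rot X)
    cancel : ∀ a b → (a +ᶻ b) -ᶻ (b +ᶻ a) ≡ 0ℤ
    cancel = solve-∀

  -- Pairing with the iterated join cycles h₁ = {0}, h_{n+1} = {0} * ∂_{n+1} h_n of top-dimensional cells.
  E : ∀ n → Cochain (suc n) → ℤ
  E zero    φ = φ (just zero ∷ [])
  E (suc n) φ = E n (D (parity n) (φ ∘ (just zero ∷_)))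

  size-rot^ : ∀ {n} j (X : Cell (suc q) n) → size (rot^ j X) ≡ size X
  size-rot^ zero    X = refl
  size-rot^ (suc j) X = trans (size-rot^ j (rot X)) (size-rot X)

  E-cong : ∀ n {φ ψ : Cochain (suc n)} → (∀ X → size X ≡ suc n → φ X ≡ ψ X) → E n φ ≡ E n ψ
  E-cong zero    h = h _ refl
  E-cong (suc n) h = E-cong n λ X full → D-cong (parity n) X
    λ j → h _ (cong suc (trans (size-rot^ j X) full))

  E-0 : ∀ n → E n (λ _ → 0ℤ) ≡ 0ℤ
  E-0 zero    = refl
  E-0 (suc n) = trans (E-cong n λ X _ → D-0 (parity n) X) (E-0 n)

  E-sub : ∀ n (φ ψ : Cochain (suc n)) → E n (λ X → φ X -ᶻ ψ X) ≡ E n φ -ᶻ E n ψ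
  E-sub zero    φ ψ = refl
  E-sub (suc n) φ ψ = trans (E-cong n λ X _ → D-sub (parity n) (φ ∘ (just zero ∷_)) (ψ ∘ (just zero ∷_)) X) (E-sub n _ _)

  E-+ : ∀ n (φ ψ : Cochain (suc n)) → E n (λ X → φ X +ᶻ ψ X) ≡ E n φ +ᶻ E n ψ
  E-+ n φ ψ = begin
    E n φ+ψ                                        ≡⟨ recover (E n φ+ψ) (E n ψ) ⟨
    (E n φ+ψ -ᶻ E n ψ) +ᶻ E n ψ                  ≡⟨ cong (_+ᶻ E n ψ) (E-sub n φ+ψ ψ) ⟨
    E n (λ X → φ+ψ X -ᶻ ψ X) +ᶻ E n ψ            ≡⟨ cong (_+ᶻ E n ψ) (E-cong n λ X _ → remove (φ X) (ψ X)) ⟩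
    E n φ +ᶻ E n ψ                                ∎
    where
    open ≡-Reasoning
    φ+ψ : Cochain (suc n)
    φ+ψ X = φ X +ᶻ ψ X
    recover : ∀ a b → (a -ᶻ b) +ᶻ b ≡ a
    recover = solve-∀
    remove : ∀ a b → (a +ᶻ b) -ᶻ b ≡ a
    remove = solve-∀

  E-δ-zero : ∀ (φ : Cochain 1) → E zero (δ φ) ≡ φ (nothing ∷ [])
  E-δ-zero φ = ℤ.+-identityʳ _

  -- Let h be the chain behind `E n` and D the differential for `parity n`. The boundary of {0} * D
  -- h is D h minus {0} * ∂ D h, and the last term is zero because D h is a cycle.
  E-δ : ∀ n (φ : Cochain (suc (suc n))) →
        E (suc n) (δ φ) ≡ E n (D (parity n) (φ ∘ (nothing ∷_)))
  E-δ n φ = begin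
    E n (D (parity n) (λ X → φ₀ X -ᶻ δ φ₁ X))                        ≡⟨ E-cong n (λ X _ → D-sub (parity n) φ₀ (δ φ₁) X) ⟩
    E n (λ X → D (parity n) φ₀ X -ᶻ D (parity n) (δ φ₁) X)           ≡⟨ E-sub n _ _ ⟩
    E n (D (parity n) φ₀) -ᶻ E n (D (parity n) (δ φ₁))               ≡⟨ cong (E n (D (parity n) φ₀) -ᶻ_) (trans (E-cong n λ X _ → sym (δ-D (parity n) φ₁ X)) (vanish n φ₁)) ⟩
    E n (D (parity n) φ₀) -ᶻ 0ℤ                                      ≡⟨ ℤ.+-identityʳ (E n (D (parity n) φ₀)) ⟩
    E n (D (parity n) φ₀)                                             ∎
    where
    open ≡-Reasoning
    φ₀ = φ ∘ (nothing ∷_)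
    φ₁ = φ ∘ (just zero ∷_)
    -- At the bottom, a point and its rotation have the same augmentation. Higher up, `E-δ` shows
    -- the boundary of h to be an image of the preceding differential, and consecutive differentials
    -- compose to zero.
    vanish : ∀ n (ψ : Cochain (suc n)) → E n (δ (D (parity n) ψ)) ≡ 0ℤ
    vanish zero    ψ = trans (E-δ-zero (D 0ℙ ψ)) (x-x≡0 (ψ (nothing ∷ [])))
    vanish (suc n) ψ = begin
      E (suc n) (δ (D (parity (suc n)) ψ))                                    ≡⟨ E-δ n (D (parity (suc n)) ψ) ⟩
      E n (D (parity n) (D (parity (suc n)) ψ ∘ (nothing ∷_)))                ≡⟨ E-cong n (λ X _ → D-cong (parity n) X λ j → D-nothing (parity (suc n)) ψ (rot^ j X)) ⟩
      E n (D (parity n) (D (parity (suc n)) (ψ ∘ (nothing ∷_))))              ≡⟨ cong (λ π → E n (D π (D (parity (suc n)) (ψ ∘ (nothing ∷_))))) (suc-homo-⁻¹ n) ⟨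
      E n (D (parity (suc n) ⁻¹) (D (parity (suc n)) (ψ ∘ (nothing ∷_))))     ≡⟨ E-cong n (λ X _ → DD≡0 (parity (suc n)) _ X) ⟩
      E n (λ _ → 0ℤ)                                                          ≡⟨ E-0 n ⟩
      0ℤ                                                                      ∎

  -- An equivariant map to ℤ[ℤ/p] is determined by its coefficient at the identity, and `φ` is that
  -- coefficient. On cells of size 1 the equation equates the augmentation with the value at the
  -- empty cell.
  ChainMap : ∀ {n} → Cochain n → Set
  ChainMap φ = ∀ X → δ φ X ≡ D (parity (size X)) φ X

  ChainMap-rot : ∀ {n} {φ : Cochain n} → ChainMap φ → ChainMap (φ ∘ rot)
  ChainMap-rot {φ = φ} h X = begin
    δ (φ ∘ rot) X                         ≡⟨ δ-rot φ X ⟩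
    δ φ (rot X)                           ≡⟨ h (rot X) ⟩
    D (parity (size (rot X))) φ (rot X)   ≡⟨ cong (λ s → D (parity s) φ (rot X)) (size-rot X) ⟩
    D (parity (size X)) φ (rot X)         ≡⟨ D-rot (parity (size X)) φ X ⟩
    D (parity (size X)) (φ ∘ rot) X       ∎
    where
    open ≡-Reasoning

  ChainMap-nothing : ∀ {n} {φ : Cochain (suc n)} → ChainMap φ → ChainMap (φ ∘ (nothing ∷_))
  ChainMap-nothing {φ = φ} h X = trans (h (nothing ∷ X)) (D-nothing (parity (size X)) φ X)

  -- On full cells the chain map equation exchanges `D` for `δ`, as `parity (suc (suc n))` reduces
  -- to `parity n`; `E-δ` then removes the first point.
  E-ChainMap : ∀ n {φ : Cochain (suc (suc n))} → ChainMap φ →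
               E (suc n) (D (parity n) φ) ≡ E n (D (parity n) (φ ∘ (nothing ∷_)))
  E-ChainMap n {φ} h = trans (E-cong (suc n) λ X full → sym (trans (h X) (cong (λ s → D (parity s) φ X) full))) (E-δ n φ)

  -- For even `n`, `E-ChainMap` says that the discrepancy `E (suc n) φ -ᶻ E n (φ ∘ (nothing ∷_))`
  -- does not change when `φ` is rotated, so each of the `m` summands contributes the same amount.
  E-orbitSum-nothing : ∀ n {φ : Cochain (suc (suc n))} → ChainMap φ → parity n ≡ 0ℙ →
    ∀ m → E (suc n) (orbitSum m φ) ≡
          E n (orbitSum m (φ ∘ (nothing ∷_))) +ᶻ ℤ.+ m *ᶻ (E (suc n) φ -ᶻ E n (φ ∘ (nothing ∷_)))
  E-orbitSum-nothing n {φ} h even zero = trans (E-0 (suc n)) (sym (trans (ℤ.+-identityʳ _) (E-0 n)))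
  E-orbitSum-nothing n {φ} h even (suc m) = begin
    E (suc n) (orbitSum (suc m) φ)                                ≡⟨ E-+ (suc n) φ (orbitSum m φ ∘ rot) ⟩
    x +ᶻ E (suc n) (orbitSum m φ ∘ rot)                          ≡⟨ cong (x +ᶻ_) (E-cong (suc n) λ X _ → orbitSum-rot m φ X) ⟩
    x +ᶻ E (suc n) (orbitSum m (φ ∘ rot))                        ≡⟨ cong (x +ᶻ_) (E-orbitSum-nothing n (ChainMap-rot h) even m) ⟩
    x +ᶻ (s +ᶻ ℤ.+ m *ᶻ (x′ -ᶻ y′))                           ≡⟨ cong (λ d → x +ᶻ (s +ᶻ ℤ.+ m *ᶻ d)) shift ⟩
    x +ᶻ (s +ᶻ ℤ.+ m *ᶻ (x -ᶻ y))                             ≡⟨ collect x y s (ℤ.+ m) ⟩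
    (y +ᶻ s) +ᶻ (1ℤ +ᶻ ℤ.+ m) *ᶻ (x -ᶻ y)                    ≡⟨ cong (λ z → (y +ᶻ z) +ᶻ (1ℤ +ᶻ ℤ.+ m) *ᶻ (x -ᶻ y)) (E-cong n λ X _ → orbitSum-rot m φ₀ X) ⟨
    (y +ᶻ E n (orbitSum m φ₀ ∘ rot)) +ᶻ ℤ.+ suc m *ᶻ (x -ᶻ y)   ≡⟨ cong (_+ᶻ ℤ.+ suc m *ᶻ (x -ᶻ y)) (E-+ n φ₀ (orbitSum m φ₀ ∘ rot)) ⟨
    E n (orbitSum (suc m) φ₀) +ᶻ ℤ.+ suc m *ᶻ (x -ᶻ y)         ∎
    where
    open ≡-Reasoning
    φ₀ = φ ∘ (nothing ∷_)
    x = E (suc n) φ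
    y = E n φ₀
    x′ = E (suc n) (φ ∘ rot)
    y′ = E n (φ₀ ∘ rot)
    s = E n (orbitSum m (φ₀ ∘ rot))
    differences : x -ᶻ x′ ≡ y -ᶻ y′
    differences = begin
      x -ᶻ x′                        ≡⟨ E-sub (suc n) φ (φ ∘ rot) ⟨
      E (suc n) (D 0ℙ φ)              ≡⟨ cong (λ π → E (suc n) (D π φ)) even ⟨
      E (suc n) (D (parity n) φ)      ≡⟨ E-ChainMap n h ⟩
      E n (D (parity n) φ₀)           ≡⟨ cong (λ π → E n (D π φ₀)) even ⟩
      E n (D 0ℙ φ₀)                   ≡⟨ E-sub n φ₀ (φ₀ ∘ rot) ⟩
      y -ᶻ y′                        ∎
    swap : ∀ a b c d → b -ᶻ d ≡ (a -ᶻ c) -ᶻ (a -ᶻ b) +ᶻ (c -ᶻ d)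
    swap = solve-∀
    shift : x′ -ᶻ y′ ≡ x -ᶻ y
    shift = begin
      x′ -ᶻ y′                                        ≡⟨ swap x x′ y y′ ⟩
      (x -ᶻ y) -ᶻ (x -ᶻ x′) +ᶻ (y -ᶻ y′)          ≡⟨ cong (λ d → (x -ᶻ y) -ᶻ d +ᶻ (y -ᶻ y′)) differences ⟩
      (x -ᶻ y) -ᶻ (y -ᶻ y′) +ᶻ (y -ᶻ y′)          ≡⟨ recover (x -ᶻ y) (y -ᶻ y′) ⟩
      x -ᶻ y                                          ∎
      where
      recover : ∀ a b → a -ᶻ b +ᶻ b ≡ a
      recover = solve-∀
    collect : ∀ x y s m → x +ᶻ (s +ᶻ m *ᶻ (x -ᶻ y)) ≡ (y +ᶻ s) +ᶻ (1ℤ +ᶻ m) *ᶻ (x -ᶻ y)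
    collect = solve-∀

  -- The augmentation of the top coefficient is a mod-p invariant of the chain map.
  E-norm : ∀ n {φ : Cochain (suc n)} → ChainMap φ → φ (empty (suc n)) ≡ 1ℤ →
           ∃ λ z → E n (D 1ℙ φ) ≡ 1ℤ +ᶻ ℤ.+ suc q *ᶻ z
  E-norm zero {φ} h φ∅≡1 = 0ℤ , (begin
    D 1ℙ φ (just zero ∷ [])     ≡⟨ h (just zero ∷ []) ⟨
    δ φ (just zero ∷ [])        ≡⟨ E-δ-zero φ ⟩
    φ (nothing ∷ [])            ≡⟨ φ∅≡1 ⟩
    1ℤ                          ≡⟨ cong (1ℤ +ᶻ_) (ℤ.*-zeroʳ (ℤ.+ suc q)) ⟨
    1ℤ +ᶻ ℤ.+ suc q *ᶻ 0ℤ     ∎)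
    where open ≡-Reasoning
  E-norm (suc n) {φ} h φ∅≡1 with E-norm n (ChainMap-nothing h) φ∅≡1 | evenOrOdd (parity n)
  -- In odd degree the norm is itself the differential, so the value passes down unchanged.
  ... | z , ih | inj₂ eq = z , (begin
    E (suc n) (D 1ℙ φ)                          ≡⟨ cong (λ π → E (suc n) (D π φ)) eq ⟨
    E (suc n) (D (parity n) φ)                  ≡⟨ E-ChainMap n h ⟩
    E n (D (parity n) (φ ∘ (nothing ∷_)))       ≡⟨ cong (λ π → E n (D π (φ ∘ (nothing ∷_)))) eq ⟩
    E n (D 1ℙ (φ ∘ (nothing ∷_)))               ≡⟨ ih ⟩
    1ℤ +ᶻ ℤ.+ suc q *ᶻ z                      ∎)
    where open ≡-Reasoning
  -- In even degree `suc q` equal discrepancies accumulate, which is a multiple of p.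
  ... | z , ih | inj₁ eq = z +ᶻ d , (begin
    E (suc n) (D 1ℙ φ)                                              ≡⟨ E-orbitSum-nothing n h eq (suc q) ⟩
    E n (D 1ℙ (φ ∘ (nothing ∷_))) +ᶻ ℤ.+ suc q *ᶻ d               ≡⟨ cong (_+ᶻ ℤ.+ suc q *ᶻ d) ih ⟩
    1ℤ +ᶻ ℤ.+ suc q *ᶻ z +ᶻ ℤ.+ suc q *ᶻ d                      ≡⟨ collect (ℤ.+ suc q) z d ⟩
    1ℤ +ᶻ ℤ.+ suc q *ᶻ (z +ᶻ d)                                  ∎)
    where
    open ≡-Reasoning
    d = E (suc n) φ -ᶻ E n (φ ∘ (nothing ∷_))
    collect : ∀ p z d → 1ℤ +ᶻ p *ᶻ z +ᶻ p *ᶻ d ≡ 1ℤ +ᶻ p *ᶻ (z +ᶻ d)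
    collect = solve-∀

  -- Partial orbit sums undo the differences of `D 0ℙ`; a mass concentrated at label `zero` undoes
  -- the sums of `D 1ℙ`.
  fill : ∀ {n} → Parity → Fin (suc q) → Cochain n → Cochain n
  fill 0ℙ a       w X = orbitSum (toℕ a) w X
  fill 1ℙ zero    w X = w X
  fill 1ℙ (suc _) w X = 0ℤ

  fill-cong : ∀ {n} π a {w w′ : Cochain n} X → (∀ j → w (rot^ j X) ≡ w′ (rot^ j X)) →
              fill π a w X ≡ fill π a w′ X
  fill-cong 0ℙ a       X h = orbitSum-cong (toℕ a) X h
  fill-cong 1ℙ zero    X h = h 0
  fill-cong 1ℙ (suc _) X h = refl

  fill-0 : ∀ {n} π a (X : Cell (suc q) n) → fill π a (λ _ → 0ℤ) X ≡ 0ℤ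
  fill-0 0ℙ a       X = orbitSum-0 (toℕ a) X
  fill-0 1ℙ zero    X = refl
  fill-0 1ℙ (suc _) X = refl

  fill-sub : ∀ {n} π a (w w′ : Cochain n) X →
           fill π a (λ Y → w Y -ᶻ w′ Y) X ≡ fill π a w X -ᶻ fill π a w′ X
  fill-sub 0ℙ a       w w′ X = orbitSum-sub (toℕ a) w w′ X
  fill-sub 1ℙ zero    w w′ X = refl
  fill-sub 1ℙ (suc _) w w′ X = refl

  δ-fill : ∀ {n} π a (w : Cochain n) X → δ (fill π a w) X ≡ fill π a (δ w) X
  δ-fill 0ℙ a       w X = δ-orbitSum (toℕ a) w X
  δ-fill 1ℙ zero    w X = refl
  δ-fill 1ℙ (suc _) w X = δ-0 X

  Equivariant : ∀ {n} → (Cell (suc q) n → Fin (suc q)) → Cell (suc q) n → Set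
  Equivariant lab X = ∀ j → lab (rot (rot^ j X)) ≡ turn (lab (rot^ j X))

  -- fill is a contracting homotopy of D (not equivariant, as it depends on a base point a).
  fill-homotopy : ∀ {n} π {lab : Cell (suc q) n → Fin (suc q)} (w : Cochain n) X → Equivariant lab X →
    D π (λ Y → fill π (lab Y) w Y) X +ᶻ fill (π ⁻¹) (lab X) (D (π ⁻¹) w) X ≡ w X
  fill-homotopy 0ℙ {lab} w X equiv rewrite equiv 0 with lab X
  -- The partial sum is empty at `X` but has `q` terms at `rot X`; the full orbit sum in the second
  -- summand makes up for it.
  ... | zero  = begin
    0ℤ -ᶻ orbitSum (toℕ (fromℕ q)) w (rot X) +ᶻ (w X +ᶻ orbitSum q w (rot X))
      ≡⟨ cong (λ m → 0ℤ -ᶻ orbitSum m w (rot X) +ᶻ (w X +ᶻ orbitSum q w (rot X))) (Fin.toℕ-fromℕ q) ⟩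
    0ℤ -ᶻ orbitSum q w (rot X) +ᶻ (w X +ᶻ orbitSum q w (rot X))
      ≡⟨ cancel (orbitSum q w (rot X)) (w X) ⟩
    w X ∎
    where
    open ≡-Reasoning
    cancel : ∀ s x → 0ℤ -ᶻ s +ᶻ (x +ᶻ s) ≡ x
    cancel = solve-∀
  ... | suc i = begin
    w X +ᶻ s -ᶻ orbitSum (toℕ (inject₁ i)) w (rot X) +ᶻ 0ℤ
      ≡⟨ cong (λ m → w X +ᶻ s -ᶻ orbitSum m w (rot X) +ᶻ 0ℤ) (Fin.toℕ-inject₁ i) ⟩
    w X +ᶻ s -ᶻ s +ᶻ 0ℤ
      ≡⟨ cancel s (w X) ⟩
    w X ∎
    where
    open ≡-Reasoning
    s = orbitSum (toℕ i) w (rot X)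
    cancel : ∀ s x → x +ᶻ s -ᶻ s +ᶻ 0ℤ ≡ x
    cancel = solve-∀
  fill-homotopy 1ℙ {lab} w X equiv =
    hit (suc q) ℕ.≤-refl X equiv (Fin.toℕ<n (lab X))
    where
    open ≡-Reasoning
    point : Cochain _
    point Y = fill 1ℙ (lab Y) w Y
    miss : ∀ m X → Equivariant lab X → m ≤ toℕ (lab X) → orbitSum m point X ≡ 0ℤ
    miss zero    X equiv le = refl
    miss (suc m) X equiv le with lab X | le | equiv 0
    ... | suc i | s≤s le′ | eq =
      trans (ℤ.+-identityˡ _) (miss m (rot X) (equiv ∘ suc)
        (subst (m ≤_) (sym (trans (cong toℕ eq) (Fin.toℕ-inject₁ i))) le′))
    -- The orbit meets label `zero` only once, as `m` is at most p, and the telescoping sum of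
    -- `D 0ℙ w` carries the value of `w` found there back to `X`.
    hit : ∀ m → m ≤ suc q → ∀ X → Equivariant lab X → toℕ (lab X) < m →
          orbitSum m point X +ᶻ orbitSum (toℕ (lab X)) (D 0ℙ w) X ≡ w X
    hit (suc m) m≤q X equiv lt with lab X | lt | equiv 0
    ... | zero | _ | eq = begin
      w X +ᶻ orbitSum m point (rot X) +ᶻ 0ℤ
        ≡⟨ cong (λ s → w X +ᶻ s +ᶻ 0ℤ) (miss m (rot X) (equiv ∘ suc)
             (subst (m ≤_) (sym (trans (cong toℕ eq) (Fin.toℕ-fromℕ q))) (ℕ.≤-pred m≤q))) ⟩
      w X +ᶻ 0ℤ +ᶻ 0ℤ
        ≡⟨ trans (ℤ.+-identityʳ (w X +ᶻ 0ℤ)) (ℤ.+-identityʳ (w X)) ⟩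
      w X ∎
    ... | suc i | s≤s lt′ | eq = begin
      0ℤ +ᶻ u +ᶻ (w X -ᶻ w (rot X) +ᶻ orbitSum (toℕ i) (D 0ℙ w) (rot X))
        ≡⟨ regroup u (w X) (w (rot X)) (orbitSum (toℕ i) (D 0ℙ w) (rot X)) ⟩
      u +ᶻ orbitSum (toℕ i) (D 0ℙ w) (rot X) +ᶻ (w X -ᶻ w (rot X))
        ≡⟨ cong (λ j → u +ᶻ orbitSum j (D 0ℙ w) (rot X) +ᶻ (w X -ᶻ w (rot X))) lab≡i ⟨
      u +ᶻ orbitSum (toℕ (lab (rot X))) (D 0ℙ w) (rot X) +ᶻ (w X -ᶻ w (rot X))
        ≡⟨ cong (_+ᶻ (w X -ᶻ w (rot X))) (hit m (ℕ.<⇒≤ m≤q) (rot X) (equiv ∘ suc) (subst (_< m) (sym lab≡i) lt′)) ⟩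
      w (rot X) +ᶻ (w X -ᶻ w (rot X))
        ≡⟨ recover (w (rot X)) (w X) ⟩
      w X ∎
      where
      u = orbitSum m point (rot X)
      lab≡i : toℕ (lab (rot X)) ≡ toℕ i
      lab≡i = trans (cong toℕ eq) (Fin.toℕ-inject₁ i)
      regroup : ∀ u x y s → 0ℤ +ᶻ u +ᶻ (x -ᶻ y +ᶻ s) ≡ u +ᶻ s +ᶻ (x -ᶻ y)
      regroup = solve-∀
      recover : ∀ y x → y +ᶻ (x -ᶻ y) ≡ x
      recover = solve-∀

-- The pair of `lev` and `lab` is an equivariant monotone map from the nonempty cells to the poset
-- of pairs (i , a) in which distinct pairs compare only through i. Level 0 is reserved for the
-- empty cell, whose orbit is not free.
record Labelling (q n : ℕ) : Set where
  field
    lev       : Cell (suc q) n → ℕ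
    lab       : Cell (suc q) n → Fin (suc q)
    lev-empty : lev (empty n) ≡ 0
    lev≡0     : ∀ X → lev X ≡ 0 → size X ≡ 0
    lev-rot   : ∀ X → lev (rot X) ≡ lev X
    lab-rot   : ∀ X → lev X ≢ 0 → lab (rot X) ≡ turn (lab X)
    lev-mono  : ∀ {Y X} → Y ⋖ X → lev Y ≤ lev X
    lab-⋖     : ∀ {Y X} → Y ⋖ X → lev X ≢ 0 → lev Y ≡ lev X → lab Y ≡ lab X

-- By induction on i, the subcomplex of cells of level at most i admits an equivariant chain map to the
-- periodic resolution that vanishes above dimension i.  Equal labels on comparable cells of level i + 1 make
-- these cells split into p disjoint translates of one piece, over which fill extends the map by one degree.
module Extension {q n : ℕ} (L : Labelling q n) where
  open Labelling L
  open Cochains q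

  Φ : ℕ → Cochain n
  Φ zero X with size X
  ... | zero  = 1ℤ
  ... | suc _ = 0ℤ
  Φ (suc i) X with lev X ℕ.≟ suc i
  ... | yes _ = fill (parity (size X)) (lab X) (δ (Φ i)) X
  ... | no  _ = Φ i X

  Φ-new : ∀ i X → lev X ≡ suc i → Φ (suc i) X ≡ fill (parity (size X)) (lab X) (δ (Φ i)) X
  Φ-new i X eq with lev X ℕ.≟ suc i
  ... | yes _ = refl
  ... | no ≢  = contradiction eq ≢

  Φ-old : ∀ i X → lev X ≢ suc i → Φ (suc i) X ≡ Φ i X
  Φ-old i X ≢ with lev X ℕ.≟ suc i
  ... | yes eq = contradiction eq ≢
  ... | no _   = refl

  Φ₀≡1 : ∀ X → size X ≡ 0 → Φ 0 X ≡ 1ℤ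
  Φ₀≡1 X eq with size X
  ... | zero = refl

  Φ₀-size : ∀ X → size X ≢ 0 → Φ 0 X ≡ 0ℤ
  Φ₀-size X ≢0 with size X
  ... | zero  = contradiction refl ≢0
  ... | suc _ = refl

  Φ-empty : ∀ i → Φ i (empty n) ≡ 1ℤ
  Φ-empty zero = Φ₀≡1 (empty n) (size-empty n)
  Φ-empty (suc i) = trans (Φ-old i (empty n) λ eq → contradiction (trans (sym lev-empty) eq) λ ()) (Φ-empty i)

  lev-rot^ : ∀ j X → lev (rot^ j X) ≡ lev X
  lev-rot^ zero    X = refl
  lev-rot^ (suc j) X = trans (lev-rot^ j (rot X)) (lev-rot X)

  Φ-level : ∀ i X → i < lev X → Φ i X ≡ 0ℤ
  Φ-level zero    X lt = Φ₀-size X λ size≡0 → ℕ.n≮0 (subst (0 <_) (lev-size X size≡0) lt)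
    where
    empty-unique : ∀ {n} (X : Cell (suc q) n) → size X ≡ 0 → X ≡ empty n
    empty-unique []            eq = refl
    empty-unique (nothing ∷ X) eq = cong (nothing ∷_) (empty-unique X eq)
    lev-size : ∀ X → size X ≡ 0 → lev X ≡ 0
    lev-size X eq = trans (cong lev (empty-unique X eq)) lev-empty
  Φ-level (suc i) X lt = trans (Φ-old i X λ eq → ℕ.<-irrefl (sym eq) lt) (Φ-level i X (ℕ.<⇒≤ lt))

  δΦ-size : ∀ i X → (∀ Y → i < size Y → Φ i Y ≡ 0ℤ) → suc i < size X → δ (Φ i) X ≡ 0ℤ
  δΦ-size i X h lt = trans (δ-cong X λ {Y} Y⋖X → h Y (ℕ.≤-pred (subst (suc i <_) (size-⋖ Y⋖X) lt))) (δ-0 X)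

  -- The support gains at most one dimension per stage, since `δ` looks only at faces with one entry
  -- fewer.
  Φ-size : ∀ i X → i < size X → Φ i X ≡ 0ℤ
  Φ-size zero    X lt = Φ₀-size X (ℕ.>⇒≢ lt)
  Φ-size (suc i) X lt with lev X ℕ.≟ suc i
  ... | no _  = Φ-size i X (ℕ.<⇒≤ lt)
  ... | yes _ = trans
    (fill-cong (parity (size X)) (lab X) X λ j →
      δΦ-size i (rot^ j X) (Φ-size i) (subst (suc i <_) (sym (size-rot^ j X)) lt))
    (fill-0 (parity (size X)) (lab X) X)

  -- The failure of the chain map equation: zero up to level `i`, and `δ (Φ i)` above it.
  defect : ℕ → Cochain n
  defect i X = δ (Φ i) X -ᶻ D (parity (size X)) (Φ i) X

  ChainMapUpTo : ℕ → Set
  ChainMapUpTo i = ∀ X → lev X ≤ i → δ (Φ i) X ≡ D (parity (size X)) (Φ i) X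

  defect-old : ∀ i → ChainMapUpTo i → ∀ X → lev X ≤ i → defect i X ≡ 0ℤ
  defect-old i h X le = trans (cong (_-ᶻ D (parity (size X)) (Φ i) X) (h X le)) (x-x≡0 (D (parity (size X)) (Φ i) X))

  defect-new : ∀ i X → i < lev X → defect i X ≡ δ (Φ i) X
  defect-new i X lt = begin
    δ (Φ i) X -ᶻ D π (Φ i) X        ≡⟨ cong (δ (Φ i) X -ᶻ_) (D-cong π X λ j → Φ-level i (rot^ j X) (subst (i <_) (sym (lev-rot^ j X)) lt)) ⟩
    δ (Φ i) X -ᶻ D π (λ _ → 0ℤ) X   ≡⟨ cong (δ (Φ i) X -ᶻ_) (D-0 π X) ⟩
    δ (Φ i) X -ᶻ 0ℤ                 ≡⟨ ℤ.+-identityʳ (δ (Φ i) X) ⟩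
    δ (Φ i) X                       ∎
    where
    open ≡-Reasoning
    π = parity (size X)

  -- The label of `X` serves for every face: faces of the same level share it, and on lower faces
  -- the defect is zero. A constant label lets `δ` pass through `fill`.
  Φ-face : ∀ i → ChainMapUpTo i → ∀ {Y X} → Y ⋖ X → lev X ≡ suc i →
           Φ (suc i) Y ≡ Φ i Y +ᶻ fill (parity (size Y)) (lab X) (defect i) Y
  Φ-face i h {Y} {X} Y⋖X levX with lev Y ℕ.≟ suc i
  ... | yes levY = begin
    fill π (lab Y) (δ (Φ i)) Y              ≡⟨ cong (λ a → fill π a (δ (Φ i)) Y) (lab-⋖ Y⋖X (λ eq → contradiction (trans (sym levX) eq) λ ()) (trans levY (sym levX))) ⟩
    fill π (lab X) (δ (Φ i)) Y              ≡⟨ fill-cong π (lab X) Y (λ j → sym (defect-new i (rot^ j Y) (ℕ.≤-reflexive (sym (trans (lev-rot^ j Y) levY))))) ⟩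
    fill π (lab X) (defect i) Y             ≡⟨ ℤ.+-identityˡ _ ⟨
    0ℤ +ᶻ fill π (lab X) (defect i) Y       ≡⟨ cong (_+ᶻ fill π (lab X) (defect i) Y) (Φ-level i Y (ℕ.≤-reflexive (sym levY))) ⟨
    Φ i Y +ᶻ fill π (lab X) (defect i) Y    ∎
    where
    open ≡-Reasoning
    π = parity (size Y)
  ... | no levY≢ = begin
    Φ i Y                                   ≡⟨ ℤ.+-identityʳ _ ⟨
    Φ i Y +ᶻ 0ℤ                             ≡⟨ cong (Φ i Y +ᶻ_) (fill-0 π (lab X) Y) ⟨
    Φ i Y +ᶻ fill π (lab X) (λ _ → 0ℤ) Y    ≡⟨ cong (Φ i Y +ᶻ_) (fill-cong π (lab X) Y λ j → defect-old i h (rot^ j Y) (subst (_≤ i) (sym (lev-rot^ j Y)) levY≤i)) ⟨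
    Φ i Y +ᶻ fill π (lab X) (defect i) Y    ∎
    where
    open ≡-Reasoning
    π = parity (size Y)
    levY≤i : lev Y ≤ i
    levY≤i = ℕ.≤-pred (ℕ.≤∧≢⇒< (subst (lev Y ≤_) levX (lev-mono Y⋖X)) levY≢)

  δ-defect : ∀ i s X → size X ≡ suc s → δ (defect i) X ≡ 0ℤ -ᶻ D (parity s) (δ (Φ i)) X
  δ-defect i s X eq = begin
    δ (defect i) X                                            ≡⟨ δ-cong X (λ {Y} Y⋖X → cong (λ m → δ (Φ i) Y -ᶻ D (parity m) (Φ i) Y) (suc-injective (trans (sym (size-⋖ Y⋖X)) eq))) ⟩
    δ (λ Y → δ (Φ i) Y -ᶻ D (parity s) (Φ i) Y) X             ≡⟨ δ-sub (δ (Φ i)) (D (parity s) (Φ i)) X ⟩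
    δ (δ (Φ i)) X -ᶻ δ (D (parity s) (Φ i)) X                 ≡⟨ cong₂ _-ᶻ_ (δδ≡0 (Φ i) X) (δ-D (parity s) (Φ i) X) ⟩
    0ℤ -ᶻ D (parity s) (δ (Φ i)) X                            ∎
    where open ≡-Reasoning

  -- Passing `δ` through `fill` and using `δδ≡0` leaves `w` minus the filling of `D σ w`, where
  -- `w = δ (Φ i)`; `fill-homotopy` identifies this with the differential of the new values.
  extend-new : ∀ i → ChainMapUpTo i → ∀ X → lev X ≡ suc i → ∀ s → size X ≡ suc s →
               δ (Φ (suc i)) X ≡ D (parity (size X)) (Φ (suc i)) X
  extend-new i h X levX s sizeX = begin
    δ (Φ (suc i)) X
      ≡⟨ δ-cong X (λ {Y} Y⋖X → trans (Φ-face i h Y⋖X levX)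
           (cong (λ m → Φ i Y +ᶻ fill (parity m) a (defect i) Y) (suc-injective (trans (sym (size-⋖ Y⋖X)) sizeX)))) ⟩
    δ (λ Y → Φ i Y +ᶻ fill σ a (defect i) Y) X
      ≡⟨ δ-+ (Φ i) (fill σ a (defect i)) X ⟩
    w X +ᶻ δ (fill σ a (defect i)) X
      ≡⟨ cong (w X +ᶻ_) (δ-fill σ a (defect i) X) ⟩
    w X +ᶻ fill σ a (δ (defect i)) X
      ≡⟨ cong (w X +ᶻ_) (fill-cong σ a X λ j → δ-defect i s (rot^ j X) (trans (size-rot^ j X) sizeX)) ⟩
    w X +ᶻ fill σ a (λ Y → 0ℤ -ᶻ D σ w Y) X
      ≡⟨ cong (w X +ᶻ_) (fill-sub σ a (λ _ → 0ℤ) (D σ w) X) ⟩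
    w X +ᶻ (fill σ a (λ _ → 0ℤ) X -ᶻ fill σ a (D σ w) X)
      ≡⟨ cong (λ z → w X +ᶻ (z -ᶻ fill σ a (D σ w) X)) (fill-0 σ a X) ⟩
    w X +ᶻ (0ℤ -ᶻ fill σ a (D σ w) X)
      ≡⟨ cong (_+ᶻ (0ℤ -ᶻ fill σ a (D σ w) X)) homotopy ⟨
    (d +ᶻ fill σ a (D σ w) X) +ᶻ (0ℤ -ᶻ fill σ a (D σ w) X)
      ≡⟨ cancel d (fill σ a (D σ w) X) ⟩
    d
      ≡⟨ D-cong π X (λ j → sym (trans (Φ-new i (rot^ j X) (trans (lev-rot^ j X) levX))
           (cong (λ m → fill (parity m) (lab (rot^ j X)) w (rot^ j X)) (size-rot^ j X)))) ⟩
    D π (Φ (suc i)) X ∎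
    where
    open ≡-Reasoning
    a = lab X
    π = parity (size X)
    σ = parity s
    w = δ (Φ i)
    d = D π (λ Y → fill π (lab Y) w Y) X
    π⁻¹≡σ : π ⁻¹ ≡ σ
    π⁻¹≡σ = trans (cong (λ m → parity m ⁻¹) sizeX) (suc-homo-⁻¹ s)
    equiv : Equivariant lab X
    equiv j = lab-rot (rot^ j X) λ eq → contradiction (trans (sym levX) (trans (sym (lev-rot^ j X)) eq)) λ ()
    homotopy : d +ᶻ fill σ a (D σ w) X ≡ w X
    homotopy = subst (λ τ → d +ᶻ fill τ a (D τ w) X ≡ w X) π⁻¹≡σ (fill-homotopy π {lab} w X equiv)
    cancel : ∀ d f → (d +ᶻ f) +ᶻ (0ℤ -ᶻ f) ≡ d
    cancel = solve-∀

  Φ-chainMap : ∀ i → ChainMapUpTo i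
  Φ-chainMap zero X le = begin
    δ (Φ 0) X                         ≡⟨ δ-cong X (λ Y⋖X → contradiction (trans (sym size≡0) (size-⋖ Y⋖X)) λ ()) ⟩
    δ (λ _ → 0ℤ) X                    ≡⟨ δ-0 X ⟩
    0ℤ                                ≡⟨ x-x≡0 (Φ 0 X) ⟨
    Φ 0 X -ᶻ Φ 0 X                    ≡⟨ cong (Φ 0 X -ᶻ_) (Φ₀-rot X) ⟨
    D (parity 0) (Φ 0) X              ≡⟨ cong (λ s → D (parity s) (Φ 0) X) size≡0 ⟨
    D (parity (size X)) (Φ 0) X       ∎
    where
    open ≡-Reasoning
    size≡0 = lev≡0 X (ℕ.n≤0⇒n≡0 le)
    Φ₀-rot : ∀ X → Φ 0 (rot X) ≡ Φ 0 X
    Φ₀-rot X rewrite size-rot X = refl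
  Φ-chainMap (suc i) X le with lev X ℕ.≟ suc i
  ... | yes levX = nonempty (size X) refl
    where
    nonempty : ∀ s → size X ≡ s → δ (Φ (suc i)) X ≡ D (parity (size X)) (Φ (suc i)) X
    nonempty (suc s) eq = extend-new i (Φ-chainMap i) X levX s eq
    nonempty zero    eq = contradiction (trans (sym (Φ₀≡1 X eq)) (Φ-level 0 X (subst (0 <_) (sym levX) (s≤s z≤n)))) λ ()
  ... | no levX≢ = begin
    δ (Φ (suc i)) X                       ≡⟨ δ-cong X (λ {Y} Y⋖X → Φ-old i Y λ eq → ℕ.<-irrefl eq (ℕ.≤-<-trans (lev-mono Y⋖X) lt)) ⟩
    δ (Φ i) X                             ≡⟨ Φ-chainMap i X (ℕ.≤-pred lt) ⟩
    D (parity (size X)) (Φ i) X           ≡⟨ D-cong (parity (size X)) X (λ j → sym (Φ-old i (rot^ j X) λ eq → levX≢ (trans (sym (lev-rot^ j X)) eq))) ⟩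
    D (parity (size X)) (Φ (suc i)) X     ∎
    where
    open ≡-Reasoning
    lt : lev X < suc i
    lt = ℕ.≤∧≢⇒< le levX≢

-- If `n` exceeded `d`, the chain map would vanish on all full cells and its norm would pair to 0,
-- whereas `E-norm` gives 1 modulo p.
tucker : ∀ {q n} → 1 ≤ q → (L : Labelling q n) → ∀ d → (∀ X → Labelling.lev L X ≤ d) → n ≤ d
tucker {q} {n} 1≤q L d bound with n ℕ.≤? d
... | yes n≤d = n≤d
tucker {q} {zero}  1≤q L d bound | no n≰d = contradiction z≤n n≰d
tucker {q} {suc n} 1≤q L d bound | no n≰d = contradiction (ℤ-unit (E-norm n chainMap (Φ-empty d))) λ { (s≤s ()) }
  where
  open Cochains q
  open Extension L
  chainMap : ChainMap (Φ d)
  chainMap X = Φ-chainMap d X (bound X)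
  vanishes : E n (D 1ℙ (Φ d)) ≡ 0ℤ
  vanishes = trans
    (E-cong n λ X full → trans
      (D-cong 1ℙ {Φ d} {λ _ → 0ℤ} X λ j → Φ-size d (rot^ j X) (subst (d <_) (sym (trans (size-rot^ j X) full)) (ℕ.≰⇒> n≰d)))
      (D-0 1ℙ X))
    (E-0 n)
  ℤ-unit : (∃ λ z → E n (D 1ℙ (Φ d)) ≡ 1ℤ +ᶻ ℤ.+ suc q *ᶻ z) → 2 ≤ 1
  ℤ-unit (z , eq) = subst (2 ≤_) (ℕ.m*n≡1⇒m≡1 (suc q) ℤ.∣ z ∣ product≡1) (s≤s 1≤q)
    where
    open ≡-Reasoning
    isolate : ∀ x → ℤ.- x ≡ 1ℤ -ᶻ (1ℤ +ᶻ x)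
    isolate = solve-∀
    product≡1 : suc q * ℤ.∣ z ∣ ≡ 1
    product≡1 = begin
      suc q * ℤ.∣ z ∣                             ≡⟨ ℤ.abs-* (ℤ.+ suc q) z ⟨
      ℤ.∣ ℤ.+ suc q *ᶻ z ∣                        ≡⟨ ℤ.∣-i∣≡∣i∣ (ℤ.+ suc q *ᶻ z) ⟨
      ℤ.∣ ℤ.- (ℤ.+ suc q *ᶻ z) ∣                  ≡⟨ cong ℤ.∣_∣ (isolate (ℤ.+ suc q *ᶻ z)) ⟩
      ℤ.∣ 1ℤ -ᶻ (1ℤ +ᶻ ℤ.+ suc q *ᶻ z) ∣          ≡⟨ cong (λ x → ℤ.∣ 1ℤ -ᶻ x ∣) (trans (sym eq) vanishes) ⟩
      1                                           ∎

-- Matchings of prime size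

∑-cong : ∀ n {f g : Fin n → ℕ} → (∀ i → f i ≡ g i) → ∑ n f ≡ ∑ n g
∑-cong zero    h = refl
∑-cong (suc n) h = cong₂ _+_ (h zero) (∑-cong n (h ∘ suc))

∑-mono : ∀ n {f g : Fin n → ℕ} → (∀ i → f i ≤ g i) → ∑ n f ≤ ∑ n g
∑-mono zero    h = z≤n
∑-mono (suc n) h = ℕ.+-mono-≤ (h zero) (∑-mono n (h ∘ suc))

∑-const : ∀ n c → ∑ n (λ _ → c) ≡ n * c
∑-const zero    c = refl
∑-const (suc n) c = cong (c +_) (∑-const n c)

∑-bound : ∀ n {f : Fin n → ℕ} c → (∀ i → f i ≤ c) → ∑ n f ≤ n * c
∑-bound n c h = subst (_ ≤_) (∑-const n c) (∑-mono n h)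

∑-+ : ∀ n (f g : Fin n → ℕ) → ∑ n (λ i → f i + g i) ≡ ∑ n f + ∑ n g
∑-+ zero    f g = refl
∑-+ (suc n) f g = trans (cong (f zero + g zero +_) (∑-+ n (f ∘ suc) (g ∘ suc)))
                        (ℕSolver.solve 4 (λ a b c d → a :+ b :+ (c :+ d) := a :+ c :+ (b :+ d)) refl
                           (f zero) (g zero) (∑ n (f ∘ suc)) (∑ n (g ∘ suc)))
  where open ℕSolver using (_:+_; _:=_)

+-mono-≡ : ∀ {a b c d} → a ≤ b → c ≤ d → a + c ≡ b + d → a ≡ b × c ≡ d
+-mono-≡ {a} {b} {c} {d} a≤b c≤d eq = a≡b , ℕ.+-cancelˡ-≡ a c d (trans eq (cong (_+ d) (sym a≡b)))
  where
  a≡b : a ≡ b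
  a≡b = ℕ.≤-antisym a≤b (ℕ.+-cancelʳ-≤ d b a (subst (_≤ a + d) eq (ℕ.+-monoʳ-≤ a c≤d)))

-- Levels are such sums, so comparable cells of equal level agree in every count and in every single
-- hit.
∑-mono-≡ : ∀ n {f g : Fin n → ℕ} → (∀ i → f i ≤ g i) → ∑ n f ≡ ∑ n g → ∀ i → f i ≡ g i
∑-mono-≡ (suc n) h eq zero    = proj₁ (+-mono-≡ (h zero) (∑-mono n (h ∘ suc)) eq)
∑-mono-≡ (suc n) h eq (suc i) =
  ∑-mono-≡ n (h ∘ suc) (proj₂ (+-mono-≡ (h zero) (∑-mono n (h ∘ suc)) eq)) i

∑≡0⇒≡0 : ∀ n {f : Fin n → ℕ} → ∑ n f ≡ 0 → ∀ i → f i ≡ 0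
∑≡0⇒≡0 n eq i = sym (∑-mono-≡ n (λ _ → z≤n) (trans (∑-const n 0) (trans (ℕ.*-zeroʳ n) (sym eq))) i)

∑-snoc : ∀ n (f : Fin (suc n) → ℕ) → ∑ (suc n) f ≡ ∑ n (f ∘ inject₁) + f (fromℕ n)
∑-snoc zero    f = ℕ.+-comm (f zero) 0
∑-snoc (suc n) f = trans (cong (f zero +_) (∑-snoc n (f ∘ suc))) (sym (ℕ.+-assoc (f zero) _ _))

∑-turn : ∀ q (f : Fin (suc q) → ℕ) → ∑ (suc q) (f ∘ turn) ≡ ∑ (suc q) f
∑-turn q f = trans (ℕ.+-comm (f (fromℕ q)) _) (sym (∑-snoc q f))

indicator : ∀ {P : Set} → Dec P → ℕ
indicator d = if does d then 1 else 0

indicator≤1 : ∀ {P : Set} (d : Dec P) → indicator d ≤ 1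
indicator≤1 (yes _) = s≤s z≤n
indicator≤1 (no _)  = z≤n

indicator-mono : ∀ {P Q : Set} (d : Dec P) (e : Dec Q) → (P → Q) → indicator d ≤ indicator e
indicator-mono (yes p) (yes _) f = s≤s z≤n
indicator-mono (yes p) (no ¬q) f = contradiction (f p) ¬q
indicator-mono (no _)  e       f = z≤n

indicator≡1 : ∀ {P : Set} (d : Dec P) → indicator d ≡ 1 → P
indicator≡1 (yes p) _ = p

indicator≡0 : ∀ {P : Set} (d : Dec P) → indicator d ≡ 0 → ¬ P
indicator≡0 (no ¬p) _ = ¬p

∑-singleton : ∀ {n} (a : Fin n) → ∑ n (λ b → indicator (a Fin.≟ b)) ≡ 1
∑-singleton {suc n} zero    = cong suc (trans (∑-const n 0) (ℕ.*-zeroʳ n))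
∑-singleton         (suc a) = ∑-singleton a

turn-injective : ∀ {q} {a b : Fin (suc q)} → turn a ≡ turn b → a ≡ b
turn-injective {a = zero}  {zero}  eq = refl
turn-injective {a = zero}  {suc b} eq = contradiction eq Fin.fromℕ≢inject₁
turn-injective {a = suc a} {zero}  eq = contradiction (sym eq) Fin.fromℕ≢inject₁
turn-injective {a = suc a} {suc b} eq = cong suc (Fin.inject₁-injective eq)

-- Arithmetic modulo p and equivariant choices

mod-unique : ∀ p .{{_ : NonZero p}} {a b} x y → a < p → b < p → a + x * p ≡ b + y * p → a ≡ b
mod-unique p {a} {b} x y a<p b<p eq = begin
  a                  ≡⟨ m<n⇒m%n≡m a<p ⟨
  a % p              ≡⟨ [m+kn]%n≡m%n a x p ⟨
  (a + x * p) % p    ≡⟨ cong (_% p) eq ⟩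
  (b + y * p) % p    ≡⟨ [m+kn]%n≡m%n b y p ⟩
  b % p              ≡⟨ m<n⇒m%n≡m b<p ⟩
  b                  ∎
  where open ≡-Reasoning

turn-mod : ∀ {q} {a b : Fin (suc q)} x y → suc (toℕ b) + x * suc q ≡ toℕ a + y * suc q → b ≡ turn a
turn-mod {q} {suc a} {b} x y eq = Fin.toℕ-injective (trans
  (mod-unique (suc q) x y (Fin.toℕ<n b) (ℕ.<-trans (Fin.toℕ<n a) ℕ.≤-refl) (suc-injective eq))
  (sym (Fin.toℕ-inject₁ a)))
turn-mod {q} {zero} {b} x (suc y) eq = Fin.toℕ-injective (trans
  (mod-unique (suc q) x y (Fin.toℕ<n b) ℕ.≤-refl (suc-injective eq))
  (sym (Fin.toℕ-fromℕ q)))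

residue : ∀ q → ℕ → Fin (suc q)
residue q v = fromℕ< (m%n<n v (suc q))

residue-turn : ∀ q v v′ x y → suc v′ + x * suc q ≡ v + y * suc q → residue q v′ ≡ turn (residue q v)
residue-turn q v v′ x y eq = turn-mod (v′ / p + x) (v / p + y) (begin
  suc (toℕ (residue q v′)) + (v′ / p + x) * p    ≡⟨ cong (λ m → suc m + (v′ / p + x) * p) (Fin.toℕ-fromℕ< (m%n<n v′ p)) ⟩
  suc (v′ % p) + (v′ / p + x) * p                ≡⟨ regroup (suc (v′ % p)) (v′ / p) x ⟩
  suc (v′ % p + v′ / p * p) + x * p              ≡⟨ cong (λ m → suc m + x * p) (m≡m%n+[m/n]*n v′ p) ⟨
  suc v′ + x * p                                 ≡⟨ eq ⟩
  v + y * p                                      ≡⟨ cong (_+ y * p) (m≡m%n+[m/n]*n v p) ⟩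
  v % p + v / p * p + y * p                      ≡⟨ regroup (v % p) (v / p) y ⟨
  v % p + (v / p + y) * p                        ≡⟨ cong (_+ (v / p + y) * p) (Fin.toℕ-fromℕ< (m%n<n v p)) ⟨
  toℕ (residue q v) + (v / p + y) * p            ∎)
  where
  open ≡-Reasoning
  p = suc q
  regroup : ∀ a b c → a + (b + c) * p ≡ a + b * p + c * p
  regroup a b c = trans (cong (a +_) (ℕ.*-distribʳ-+ p b c)) (sym (ℕ.+-assoc a _ _))

-- b * c ≡ 1 (mod p), with multiples of p on both sides so that no subtraction occurs; the hypotheses on c stand
-- under the ∃ so that b is a total function of c.
inverse : ∀ {q} → Prime (suc q) → ∀ c → ∃ λ b → c ≢ 0 → c < suc q → ∃₂ λ x y → b * c + x * suc q ≡ 1 + y * suc q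
inverse {q} isPrime zero = 0 , λ c≢0 _ → contradiction refl c≢0
inverse {q} isPrime (suc c) with suc c ℕ.<? suc q
... | no c≮p = 0 , λ _ c<p → contradiction c<p c≮p
... | yes c<p with coprime-Bézout (prime⇒coprime isPrime c<p)
...   | Bézout.-+ x y eq = y , λ _ _ → 0 , x , trans (ℕ.+-identityʳ _) (sym eq)
...   | Bézout.+- x y eq = y * q , λ _ _ → 1 , q * x , (begin
    y * q * suc c + 1 * suc q      ≡⟨ ℕSolver.solve 3 (λ y q c → y :* q :* c :+ con 1 :* (con 1 :+ q) := con 1 :+ q :* (con 1 :+ y :* c)) refl y q (suc c) ⟩
    1 + q * (1 + y * suc c)        ≡⟨ cong (λ m → 1 + q * m) eq ⟩
    1 + q * (x * suc q)            ≡⟨ cong (1 +_) (ℕ.*-assoc q x (suc q)) ⟨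
    1 + q * x * suc q              ∎)
    where
    open ≡-Reasoning
    open ℕSolver using (_:+_; _:*_; _:=_; con)

-- The mean moment/count in ℤ/p of a subset of ℤ/p: an equivariant choice of a point for a free orbit of subsets.
mean : ∀ {q} → Prime (suc q) → ℕ → ℕ → Fin (suc q)
mean {q} isPrime count moment = residue q (proj₁ (inverse isPrime count) * moment)

-- When the moment drops by the count modulo p, multiplication by the inverse of the count makes
-- this a drop by 1. Invertibility is the reason for `c ≢ 0` and `c < suc q`.
mean-turn : ∀ {q} (isPrime : Prime (suc q)) c m m′ e → c ≢ 0 → c < suc q → m′ + c ≡ m + e * suc q →
            mean isPrime c m′ ≡ turn (mean isPrime c m)
mean-turn {q} isPrime c m m′ e c≢0 c<p eq with inverse isPrime c
... | b , inv with inv c≢0 c<p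
...   | x , y , bc≡1 = residue-turn q (b * m) (b * m′) y (b * e + x) (begin
  suc (b * m′) + y * suc q                    ≡⟨ ℕ.+-suc (b * m′) (y * suc q) ⟨
  b * m′ + (1 + y * suc q)                    ≡⟨ cong (b * m′ +_) bc≡1 ⟨
  b * m′ + (b * c + x * suc q)                ≡⟨ ℕSolver.solve 5 (λ b m′ c x p → b :* m′ :+ (b :* c :+ x :* p) := b :* (m′ :+ c) :+ x :* p) refl b m′ c x (suc q) ⟩
  b * (m′ + c) + x * suc q                    ≡⟨ cong (λ z → b * z + x * suc q) eq ⟩
  b * (m + e * suc q) + x * suc q             ≡⟨ ℕSolver.solve 5 (λ b m e x p → b :* (m :+ e :* p) :+ x :* p := b :* m :+ (b :* e :+ x) :* p) refl b m e x (suc q) ⟩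
  b * m + (b * e + x) * suc q                 ∎)
  where
  open ≡-Reasoning
  open ℕSolver using (_:+_; _:*_; _:=_)

pick : ∀ {A : Set} t → (Fin t → ℕ) → (Fin t → A) → A → A
pick zero    c v d = d
pick (suc t) c v d with c zero
... | zero  = pick t (c ∘ suc) (v ∘ suc) d
... | suc _ = v zero

pick-map : ∀ {A : Set} (g : A → A) t {c c′ : Fin t → ℕ} {v v′ : Fin t → A} {d d′ : A} →
           (∀ i → c′ i ≡ c i) → (∀ i → c i ≢ 0 → v′ i ≡ g (v i)) → ((∀ i → c i ≡ 0) → d′ ≡ g d) →
           pick t c′ v′ d′ ≡ g (pick t c v d)
pick-map g zero    hc hv hd = hd λ ()
pick-map g (suc t) {c} {c′} hc hv hd with c′ zero | c zero in c₀ | hc zero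
... | .0       | zero  | refl = pick-map g t (hc ∘ suc) (hv ∘ suc) λ h → hd λ { zero → c₀ ; (suc i) → h i }
... | .(suc m) | suc m | refl = hv zero λ eq → contradiction (trans (sym c₀) eq) λ ()

-- Cells as families of disjoint sets

member : ∀ {p} → Fin p → Maybe (Fin p) → Bool
member ω nothing  = false
member ω (just a) = does (a Fin.≟ ω)

part : ∀ {p n} → Fin p → Cell p n → Subset n
part ω = Vec.map (member ω)

part-⋖ : ∀ {p n} (ω : Fin p) {Y X : Cell p n} → Y ⋖ X → part ω Y ⊆ part ω X
part-⋖ ω here        = out⊆ ⊆-refl
part-⋖ ω (there Y⋖X) = s⊆s (part-⋖ ω Y⋖X)

part-rot : ∀ {q n} (ω : Fin (suc q)) (X : Cell (suc q) n) → part (turn ω) (rot X) ≡ part ω X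
part-rot ω []            = refl
part-rot ω (nothing ∷ X) = cong (false ∷_) (part-rot ω X)
part-rot ω (just a ∷ X)  = cong₂ _∷_
  (does-⇔ (mk⇔ turn-injective (cong turn)) (turn a Fin.≟ turn ω) (a Fin.≟ ω)) (part-rot ω X)

part-disjoint : ∀ {p n} {ω ω′ : Fin p} (X : Cell p n) → ω ≢ ω′ → Disjoint (part ω X) (part ω′ X)
part-disjoint []            ω≢ω′ = refl
part-disjoint (nothing ∷ X) ω≢ω′ = cong (false ∷_) (part-disjoint X ω≢ω′)
part-disjoint {ω = ω} {ω′} (just a ∷ X) ω≢ω′ = cong₂ _∷_ (go (a Fin.≟ ω) (a Fin.≟ ω′)) (part-disjoint X ω≢ω′)
  where
  go : (d : Dec (a ≡ ω)) (e : Dec (a ≡ ω′)) → does d ∧ does e ≡ false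
  go (yes a≡ω) (yes a≡ω′) = contradiction (trans (sym a≡ω) a≡ω′) ω≢ω′
  go (yes _)   (no _)     = refl
  go (no _)    _          = refl

∣∷∣ : ∀ {n} b (S : Subset n) → ∣ b ∷ S ∣ ≡ (if b then 1 else 0) + ∣ S ∣
∣∷∣ false S = refl
∣∷∣ true  S = refl

∑-∣part∣ : ∀ {p n} (X : Cell p n) → ∑ p (λ ω → ∣ part ω X ∣) ≡ size X
∑-∣part∣ {p} []            = trans (∑-const p 0) (ℕ.*-zeroʳ p)
∑-∣part∣ {p} (nothing ∷ X) = ∑-∣part∣ X
∑-∣part∣ {p} (just a ∷ X)  = begin
  ∑ p (λ ω → ∣ part ω (just a ∷ X) ∣)                                  ≡⟨ ∑-cong p (λ ω → ∣∷∣ (member ω (just a)) (part ω X)) ⟩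
  ∑ p (λ ω → indicator (a Fin.≟ ω) + ∣ part ω X ∣)                     ≡⟨ ∑-+ p _ _ ⟩
  ∑ p (λ ω → indicator (a Fin.≟ ω)) + ∑ p (λ ω → ∣ part ω X ∣)         ≡⟨ cong₂ _+_ (∑-singleton a) (∑-∣part∣ X) ⟩
  suc (size X)                                                        ∎
  where open ≡-Reasoning

firstSign : ∀ {q n} → Cell (suc q) n → Fin (suc q)
firstSign []            = zero
firstSign (nothing ∷ X) = firstSign X
firstSign (just a ∷ X)  = a

firstSign-rot : ∀ {q n} (X : Cell (suc q) n) → size X ≢ 0 → firstSign (rot X) ≡ turn (firstSign X)
firstSign-rot []            ≢0 = contradiction refl ≢0
firstSign-rot (nothing ∷ X) ≢0 = firstSign-rot X ≢0
firstSign-rot (just a ∷ X)  ≢0 = refl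

subsetOfSize : ∀ {n} r (U : Subset n) → r ≤ ∣ U ∣ → ∃ λ S → S ⊆ U × ∣ S ∣ ≡ r
subsetOfSize zero    []          le       = [] , (λ ()) , refl
subsetOfSize r       (false ∷ U) le       with subsetOfSize r U le
... | S , S⊆U , ∣S∣≡r = false ∷ S , out⊆ S⊆U , ∣S∣≡r
subsetOfSize zero    (true ∷ U)  le       with subsetOfSize zero U z≤n
... | S , S⊆U , ∣S∣≡r = false ∷ S , out⊆ S⊆U , ∣S∣≡r
subsetOfSize (suc r) (true ∷ U)  (s≤s le) with subsetOfSize r U le
... | S , S⊆U , ∣S∣≡r = true ∷ S , s⊆s S⊆U , cong suc ∣S∣≡r

anyCell? : ∀ {p n} {P : Cell p n → Set} → (∀ X → Dec (P X)) → Dec (∃ P)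
anyCell? {n = zero}  P? = map′ ([] ,_) (λ { ([] , P[]) → P[] }) (P? [])
anyCell? {n = suc n} P? = map′
  (λ { (inj₁ (X , PX)) → _ , PX ; (inj₂ (a , X , PX)) → _ , PX })
  (λ { (nothing ∷ X , PX) → inj₁ (X , PX) ; (just a ∷ X , PX) → inj₂ (a , X , PX) })
  (anyCell? (P? ∘ (nothing ∷_)) ⊎-dec Fin.any? λ a → anyCell? (P? ∘ (just a ∷_)))

Disjoint-⊆ : ∀ {n} {S S′ A B : Subset n} → S ⊆ A → S′ ⊆ B → Disjoint A B → Disjoint S S′
Disjoint-⊆ {S = S} {S′} {A} {B} S⊆A S′⊆B A∩B≡∅ = Empty-unique λ { (x , x∈S∩S′) →
  let x∈S , x∈S′ = x∈p∩q⁻ S S′ x∈S∩S′ in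
  ∉⊥ (subst (x ∈_) A∩B≡∅ (x∈p∩q⁺ (S⊆A x∈S , S′⊆B x∈S′))) }

Disjoint-sym : ∀ {n} {A B : Subset n} → Disjoint A B → Disjoint B A
Disjoint-sym {A = A} {B} A∩B≡∅ = trans (∩-comm B A) A∩B≡∅

-- Repetition is possible only for the empty set; for `1 ≤ r` distinctness follows from
-- disjointness.
Matching : ∀ {n} → (Subset n → Set) → ℕ → Set
Matching {n} P k = Σ (Fin k → Subset n) λ f → (∀ a → P (f a)) × (∀ a b → a ≢ b → Disjoint (f a) (f b))

Mono : ∀ {n t} → ℕ → (Subset n → Fin t) → Fin t → Subset n → Set
Mono r χ i S = ∣ S ∣ ≡ r × χ S ≡ i

MatchingProp : (n r t : ℕ) → (Fin t → ℕ) → Set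
MatchingProp n r t m = (χ : Subset n → Fin t) → ∃ λ i → Matching (Mono r χ i) (m i)

module PrimeMatching {q} (isPrime : Prime (suc q)) (ρ : ℕ) {n t} (χ : Subset n → Fin t) where

  p = suc q

  Hit : Fin t → Cell p n → Fin p → Set
  Hit i X ω = ∃ λ S → S ⊆ part ω X × ∣ S ∣ ≡ suc ρ × χ S ≡ i

  hit? : ∀ i X ω → Dec (Hit i X ω)
  hit? i X ω = anySubset? λ S → S ⊆? part ω X ×-dec ∣ S ∣ ℕ.≟ suc ρ ×-dec χ S Fin.≟ i

  Hit-rot : ∀ {i X ω} → Hit i X ω → Hit i (rot X) (turn ω)
  Hit-rot {i} {X} {ω} = subst (λ U → ∃ λ S → S ⊆ U × ∣ S ∣ ≡ suc ρ × χ S ≡ i) (sym (part-rot ω X))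

  Hit-unrot : ∀ {i X ω} → Hit i (rot X) (turn ω) → Hit i X ω
  Hit-unrot {i} {X} {ω} = subst (λ U → ∃ λ S → S ⊆ U × ∣ S ∣ ≡ suc ρ × χ S ≡ i) (part-rot ω X)

  hits : Fin t → Cell p n → Fin p → ℕ
  hits i X ω = indicator (hit? i X ω)

  hits-rot : ∀ i X ω → hits i (rot X) (turn ω) ≡ hits i X ω
  hits-rot i X ω = ℕ.≤-antisym (indicator-mono (hit? i (rot X) (turn ω)) (hit? i X ω) Hit-unrot)
                               (indicator-mono (hit? i X ω) (hit? i (rot X) (turn ω)) Hit-rot)

  hits-⋖ : ∀ i {Y X} → Y ⋖ X → ∀ ω → hits i Y ω ≤ hits i X ω
  hits-⋖ i {Y} {X} Y⋖X ω = indicator-mono (hit? i Y ω) (hit? i X ω)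
    λ { (S , S⊆Y , rest) → S , ⊆-trans S⊆Y (part-⋖ ω Y⋖X) , rest }

  count moment : Fin t → Cell p n → ℕ
  count  i X = ∑ p (hits i X)
  moment i X = ∑ p (λ ω → toℕ ω * hits i X ω)

  count-rot : ∀ i X → count i (rot X) ≡ count i X
  count-rot i X = trans (sym (∑-turn q (hits i (rot X)))) (∑-cong p (hits-rot i X))

  -- Reindexing by `turn` lowers each index by 1, except that index 0 wraps round to `q` and so
  -- comes out p too large.
  moment-rot : ∀ i X → moment i (rot X) + count i X ≡ moment i X + hits i X zero * p
  moment-rot i X = begin
    moment i (rot X) + count i X                                    ≡⟨ cong (_+ count i X) (∑-turn q (λ ω → toℕ ω * hits i (rot X) ω)) ⟨
    ∑ p (λ ω → toℕ (turn ω) * hits i (rot X) (turn ω)) + count i X  ≡⟨ cong (_+ count i X) (∑-cong p λ ω → cong (toℕ (turn ω) *_) (hits-rot i X ω)) ⟩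
    ∑ p (λ ω → toℕ (turn ω) * h ω) + ∑ p h                          ≡⟨ ∑-+ p (λ ω → toℕ (turn ω) * h ω) h ⟨
    ∑ p (λ ω → toℕ (turn ω) * h ω + h ω)                            ≡⟨ cong₂ _+_ wrapped (∑-cong q λ ω → step (suc ω) refl) ⟩
    h zero * p + ∑ q (λ ω → toℕ (suc ω) * h (suc ω))                ≡⟨ ℕ.+-comm (h zero * p) _ ⟩
    moment i X + h zero * p                                         ∎
    where
    open ≡-Reasoning
    h = hits i X
    wrapped : toℕ (fromℕ q) * h zero + h zero ≡ h zero * p
    wrapped = trans (cong (λ m → m * h zero + h zero) (Fin.toℕ-fromℕ q))
                    (trans (ℕ.+-comm (q * h zero) (h zero)) (ℕ.*-comm p (h zero)))
    step : ∀ (ω : Fin p) {ω′} → ω ≡ suc ω′ → toℕ (turn ω) * h ω + h ω ≡ toℕ ω * h ω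
    step (suc ω) refl = trans (cong (λ m → m * h (suc ω) + h (suc ω)) (Fin.toℕ-inject₁ ω))
                              (ℕ.+-comm (toℕ ω * h (suc ω)) (h (suc ω)))

  -- A set of `suc ρ` points inside a part would have some colour and be a hit, so each part has at
  -- most `ρ` points.
  uncovered-small : ∀ X → (∀ i → count i X ≡ 0) → size X ≤ p * ρ
  uncovered-small X none = subst (_≤ p * ρ) (∑-∣part∣ X) (∑-bound p ρ λ ω → ℕ.≤-pred (ℕ.≰⇒> (noLarge ω)))
    where
    noLarge : ∀ ω → ¬ suc ρ ≤ ∣ part ω X ∣
    noLarge ω le with subsetOfSize (suc ρ) (part ω X) le
    ... | S , S⊆ , ∣S∣ = indicator≡0 (hit? (χ S) X ω) (∑≡0⇒≡0 p {hits (χ S) X} (none (χ S)) ω) (S , S⊆ , ∣S∣ , refl)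

  -- The truncation keeps the level bounded. By `uncovered-small` it has no effect on cells without
  -- hits, where size alone must separate comparable cells.
  level : Cell p n → ℕ
  level X = ∑ t (λ i → count i X) + size X ⊓ (p * ρ)

  -- The first colour with a hit decides through the mean position of its hits; the first entry of
  -- the cell is the fallback when there are none.
  label : Cell p n → Fin p
  label X = pick t (λ i → count i X) (λ i → mean isPrime (count i X) (moment i X)) (firstSign X)

  count-⋖ : ∀ i {Y X} → Y ⋖ X → count i Y ≤ count i X
  count-⋖ i Y⋖X = ∑-mono p (hits-⋖ i Y⋖X)

  size-≤ : ∀ {Y X : Cell p n} → Y ⋖ X → size Y ≤ size X
  size-≤ Y⋖X = ℕ.≤-trans (ℕ.n≤1+n _) (ℕ.≤-reflexive (sym (size-⋖ Y⋖X)))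

  level≡0 : ∀ X → level X ≡ 0 → size X ≡ 0
  level≡0 X eq = trans (sym (ℕ.m≤n⇒m⊓n≡m (uncovered-small X (∑≡0⇒≡0 t (ℕ.m+n≡0⇒m≡0 _ eq)))))
                       (ℕ.m+n≡0⇒n≡0 (∑ t (λ i → count i X)) eq)

  level-empty : level (empty n) ≡ 0
  level-empty = cong₂ _+_
    (trans (∑-cong t λ i → trans (∑-cong p (nohit i)) (trans (∑-const p 0) (ℕ.*-zeroʳ p)))
           (trans (∑-const t 0) (ℕ.*-zeroʳ t)))
    (cong (_⊓ (p * ρ)) (size-empty n))
    where
    ∣part-empty∣ : ∀ ω n → ∣ part {p} ω (empty n) ∣ ≡ 0
    ∣part-empty∣ ω zero    = refl
    ∣part-empty∣ ω (suc n) = ∣part-empty∣ ω n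
    nohit : ∀ i ω → hits i (empty n) ω ≡ 0
    nohit i ω with hit? i (empty n) ω
    ... | no _ = refl
    ... | yes (S , S⊆ , ∣S∣ , _) = contradiction (subst₂ _≤_ ∣S∣ (∣part-empty∣ ω n) (p⊆q⇒∣p∣≤∣q∣ S⊆)) λ ()

  level-rot : ∀ X → level (rot X) ≡ level X
  level-rot X = cong₂ _+_ (∑-cong t λ i → count-rot i X) (cong (_⊓ (p * ρ)) (size-rot X))

  level-⋖ : ∀ {Y X} → Y ⋖ X → level Y ≤ level X
  level-⋖ Y⋖X = ℕ.+-mono-≤ (∑-mono t λ i → count-⋖ i Y⋖X) (ℕ.⊓-monoˡ-≤ (p * ρ) (size-≤ Y⋖X))

  label-⋖ : ∀ {Y X} → Y ⋖ X → level Y ≡ level X → label Y ≡ label X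
  label-⋖ {Y} {X} Y⋖X eq = pick-map id t counts
    (λ i _ → cong₂ (mean isPrime) (counts i)
      (∑-cong p λ ω → cong (toℕ ω *_) (∑-mono-≡ p (hits-⋖ i Y⋖X) (counts i) ω)))
    -- The fallback labels might differ, but without hits equal levels mean equal sizes, which
    -- `Y ⋖ X` excludes.
    λ none → contradiction (sizes none) λ eq → ℕ.1+n≢n (trans (sym (size-⋖ Y⋖X)) (sym eq))
    where
    parts = +-mono-≡ (∑-mono t λ i → count-⋖ i Y⋖X) (ℕ.⊓-monoˡ-≤ (p * ρ) (size-≤ Y⋖X)) eq
    counts : ∀ i → count i Y ≡ count i X
    counts = ∑-mono-≡ t (λ i → count-⋖ i Y⋖X) (proj₁ parts)
    sizes : (∀ i → count i X ≡ 0) → size Y ≡ size X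
    sizes none = begin
      size Y               ≡⟨ ℕ.m≤n⇒m⊓n≡m (ℕ.≤-trans (size-≤ Y⋖X) small) ⟨
      size Y ⊓ (p * ρ)     ≡⟨ proj₂ parts ⟩
      size X ⊓ (p * ρ)     ≡⟨ ℕ.m≤n⇒m⊓n≡m small ⟩
      size X               ∎
      where
      open ≡-Reasoning
      small = uncovered-small X none

  Covered : Cell p n → Fin t → Set
  Covered X i = ∀ ω → Hit i X ω

  count<p : ∀ i X → ¬ Covered X i → count i X < p
  count<p i X ¬all = ℕ.≤∧≢⇒< (subst (count i X ≤_) (ℕ.*-identityʳ p) (∑-bound p 1 λ ω → indicator≤1 (hit? i X ω)))
    λ eq → ¬all λ ω → indicator≡1 (hit? i X ω)
      (∑-mono-≡ p (λ ω → indicator≤1 (hit? i X ω)) (trans eq (trans (sym (ℕ.*-identityʳ p)) (sym (∑-const p 1)))) ω)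

  label-rot : (∀ X i → ¬ Covered X i) → ∀ X → level X ≢ 0 → label (rot X) ≡ turn (label X)
  label-rot ¬covered X level≢0 = pick-map turn t (λ i → count-rot i X)
    (λ i c≢0 → trans (cong (λ c → mean isPrime c (moment i (rot X))) (count-rot i X))
      (mean-turn isPrime (count i X) (moment i X) (moment i (rot X)) (hits i X zero) c≢0
        (count<p i X (¬covered X i)) (moment-rot i X)))
    λ none → firstSign-rot X λ size≡0 → level≢0
      (cong₂ _+_ (trans (∑-cong t none) (trans (∑-const t 0) (ℕ.*-zeroʳ t))) (cong (_⊓ (p * ρ)) size≡0))

  labelling : (∀ X i → ¬ Covered X i) → Labelling q n
  labelling ¬covered = record
    { lev       = level
    ; lab       = label
    ; lev-empty = level-empty
    ; lev≡0     = level≡0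
    ; lev-rot   = level-rot
    ; lab-rot   = label-rot ¬covered
    ; lev-mono  = level-⋖
    ; lab-⋖     = λ Y⋖X _ eq → label-⋖ Y⋖X eq
    }

  level-bound : (∀ X i → ¬ Covered X i) → ∀ X → level X ≤ t * q + p * ρ
  level-bound ¬covered X = ℕ.+-mono-≤ (∑-bound t q λ i → ℕ.≤-pred (count<p i X (¬covered X i)))
                                      (ℕ.m⊓n≤n (size X) (p * ρ))

  covered : t * q + p * ρ < n → ∃₂ Covered
  -- The search is finite, so refuting the absence of a covered cell produces one.
  covered lt with anyCell? (λ X → Fin.any? λ i → Fin.all? (hit? i X))
  ... | yes found = found
  ... | no ¬found = contradiction (tucker 1≤q (labelling none) _ (level-bound none)) (ℕ.<⇒≱ lt)
    where
    none : ∀ X i → ¬ Covered X i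
    none X i cov = ¬found (X , i , cov)
    1≤q : 1 ≤ q
    1≤q = ℕ.≤-pred (nonTrivial⇒n>1 (suc q) {{prime⇒nonTrivial isPrime}})

  matching : t * q + p * ρ < n → ∃ λ i → Matching (Mono (suc ρ) χ i) p
  matching lt with covered lt
  ... | X , i , hit = i , (λ ω → proj₁ (hit ω)) , (λ ω → proj₂ (proj₂ (hit ω))) ,
    λ ω ω′ ω≢ω′ → Disjoint-⊆ (proj₁ (proj₂ (hit ω))) (proj₁ (proj₂ (hit ω′))) (part-disjoint X ω≢ω′)

-- Matchings of arbitrary size

-- Transport along the increasing bijection from `Fin ∣ U ∣` to `U`.
embed : ∀ {n} (U : Subset n) → Subset ∣ U ∣ → Subset n
embed []          []      = []
embed (true ∷ U)  (b ∷ S) = b ∷ embed U S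
embed (false ∷ U) S       = false ∷ embed U S

embed-⊆ : ∀ {n} (U : Subset n) S → embed U S ⊆ U
embed-⊆ []          []          = ⊆-refl
embed-⊆ (true ∷ U)  (true ∷ S)  = s⊆s (embed-⊆ U S)
embed-⊆ (true ∷ U)  (false ∷ S) = out⊆ (embed-⊆ U S)
embed-⊆ (false ∷ U) S           = out⊆ (embed-⊆ U S)

∣embed∣ : ∀ {n} (U : Subset n) S → ∣ embed U S ∣ ≡ ∣ S ∣
∣embed∣ []          []          = refl
∣embed∣ (true ∷ U)  (true ∷ S)  = cong suc (∣embed∣ U S)
∣embed∣ (true ∷ U)  (false ∷ S) = ∣embed∣ U S
∣embed∣ (false ∷ U) S           = ∣embed∣ U S

embed-disjoint : ∀ {n} (U : Subset n) {S S′} → Disjoint S S′ → Disjoint (embed U S) (embed U S′)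
embed-disjoint []          {[]}     {[]}      eq = refl
embed-disjoint (true ∷ U)  {b ∷ S}  {b′ ∷ S′} eq = cong₂ _∷_ (∷-injectiveˡ eq) (embed-disjoint U (∷-injectiveʳ eq))
embed-disjoint (false ∷ U) {S}      {S′}      eq = cong (false ∷_) (embed-disjoint U eq)

matchingInside : ∀ {n r t m} → (U : Subset n) → MatchingProp ∣ U ∣ r t m → (χ : Subset n → Fin t) →
                 ∃ λ i → Matching (λ S → S ⊆ U × Mono r χ i S) (m i)
matchingInside U prop χ with prop (χ ∘ embed U)
... | i , f , good , disjoint =
  i , embed U ∘ f ,
  (λ a → embed-⊆ U (f a) , trans (∣embed∣ U (f a)) (proj₁ (good a)) , proj₂ (good a)) ,
  λ a b a≢b → embed-disjoint U (disjoint a b a≢b)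

-- The Alon–Frankl–Lovász theorem on k-matchings of r-sets in t = suc u colours.
EvenMatching : ℕ → Set
EvenMatching k = ∀ u r n → n ≡ k * r + u * (k ∸ 1) → MatchingProp n r (suc u) (λ _ → k)

evenMatching-1 : EvenMatching 1
evenMatching-1 u r n refl χ
  with subsetOfSize r ⊤ (subst (r ≤_) (sym (∣⊤∣≡n n)) (ℕ.m≤n⇒m≤n+o (u * 0) (ℕ.m≤m+n r 0)))
... | S , _ , ∣S∣≡r = χ S , (λ _ → S) , (λ _ → ∣S∣≡r , refl) , λ { zero zero 0≢0 → contradiction refl 0≢0 }

evenMatching-prime : ∀ {k} → Prime k → EvenMatching k
evenMatching-prime {zero}  isPrime = contradiction isPrime ¬prime[0]
evenMatching-prime {suc q} isPrime u zero    n _ χ =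
  χ ⊥ , (λ _ → ⊥) , (λ _ → ∣⊥∣≡0 n , refl) , λ _ _ _ → ∩-idem ⊥
-- The number of points exceeds the largest possible level by exactly one.
evenMatching-prime {suc q} isPrime u (suc ρ) n eq χ = PrimeMatching.matching isPrime ρ χ (ℕ.≤-reflexive
  (trans (solve 3 (λ q u ρ → con 1 :+ ((con 1 :+ u) :* q :+ (con 1 :+ q) :* ρ) :=
                             (con 1 :+ q) :* (con 1 :+ ρ) :+ u :* q) refl q u ρ) (sym eq)))
  where open ℕSolver using (solve; _:+_; _:*_; _:=_; con)

refineMatching : ∀ {n k l} {P Q : Subset n → Set} →
                 (∀ R → P R → Matching (λ S → S ⊆ R × Q S) l) → Matching P k → Matching Q (k * l)
refineMatching {n} {k} {l} {P} {Q} inner (f , good , disjoint) =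
  (λ x → piece (remQuot l x)) , (λ x → piece-good (remQuot l x)) ,
  λ x y x≢y → piece-disjoint (remQuot l x) (remQuot l y) (x≢y ∘ remQuot-injective)
  where
  piece : Fin k × Fin l → Subset n
  piece (β , α) = proj₁ (inner (f β) (good β)) α
  piece-⊆ : ∀ β α → piece (β , α) ⊆ f β
  piece-⊆ β α = proj₁ (proj₁ (proj₂ (inner (f β) (good β))) α)
  piece-good : ∀ βα → Q (piece βα)
  piece-good (β , α) = proj₂ (proj₁ (proj₂ (inner (f β) (good β))) α)
  piece-disjoint : ∀ βα βα′ → βα ≢ βα′ → Disjoint (piece βα) (piece βα′)
  piece-disjoint (β , α) (β′ , α′) ≢ with β Fin.≟ β′
  ... | yes refl = proj₂ (proj₂ (inner (f β) (good β))) α α′ λ α≡α′ → ≢ (cong (β ,_) α≡α′)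
  ... | no β≢β′  = Disjoint-⊆ (piece-⊆ β α) (piece-⊆ β′ α′) (disjoint β β′ β≢β′)
  remQuot-injective : ∀ {x y} → remQuot {k} l x ≡ remQuot l y → x ≡ y
  remQuot-injective {x} {y} eq = trans (sym (Fin.combine-remQuot {k} l x))
    (trans (cong (uncurry combine) eq) (Fin.combine-remQuot {k} l y))

-- The induced colouring is meaningful only on sets of one size; elsewhere it takes a default
-- colour, because colourings are total functions.
totalise : ∀ {A I : Set} {P : A → Set} {Q : A → I → Set} → I → (∀ x → Dec (P x)) →
           (∀ x → P x → ∃ (Q x)) → Σ (A → I) λ χ → ∀ x → P x → Q x (χ x)
totalise {A} {I} {P} {Q} default P? f = (λ x → proj₁ (value x)) , λ x → proj₂ (value x)
  where
  value : ∀ x → Σ I λ i → P x → Q x i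
  value x with P? x
  ... | yes Px = proj₁ (f x Px) , λ _ → proj₂ (f x Px)
  ... | no ¬Px = default , λ Px → contradiction Px ¬Px

-- The bound is multiplicative: the outer matching can consist of sets of exactly the size that the
-- inner matching requires.
points-* : ∀ a b r u → suc b * suc a * r + u * (a + b * suc a) ≡ suc b * (suc a * r + u * a) + u * b
points-* a b r u = solve 4 (λ a b r u →
    (con 1 :+ b) :* (con 1 :+ a) :* r :+ u :* (a :+ b :* (con 1 :+ a)) :=
    (con 1 :+ b) :* ((con 1 :+ a) :* r :+ u :* a) :+ u :* b) refl a b r u
  where open ℕSolver using (solve; _:+_; _:*_; _:=_; con)

-- Colour a set of a r + (t - 1)(a - 1) points by the colour of some monochromatic a-matching inside it.
evenMatching-* : ∀ {a b} → EvenMatching (suc a) → EvenMatching (suc b) → EvenMatching (suc b * suc a)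
evenMatching-* {a} {b} matchA matchB u r n eq χ = refine (matchB u r′ n sizes χ′)
  where
  r′ = suc a * r + u * a
  sizes : n ≡ suc b * r′ + u * b
  sizes = trans eq (points-* a b r u)
  Inner : Subset n → Fin (suc u) → Set
  Inner R i = Matching (λ S → S ⊆ R × Mono r χ i S) (suc a)
  colouring : Σ (Subset n → Fin (suc u)) λ χ′ → ∀ R → ∣ R ∣ ≡ r′ → Inner R (χ′ R)
  colouring = totalise zero (λ R → ∣ R ∣ ℕ.≟ r′) λ R ∣R∣≡r′ → matchingInside R (matchA u r ∣ R ∣ ∣R∣≡r′) χ
  χ′ = proj₁ colouring
  inner-χ′ : ∀ i R → Mono r′ χ′ i R → Inner R i
  inner-χ′ i R (∣R∣≡r′ , χ′≡i) = subst (Inner R) χ′≡i (proj₂ colouring R ∣R∣≡r′)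
  refine : (∃ λ i → Matching (Mono r′ χ′ i) (suc b)) →
           ∃ λ i → Matching (Mono r χ i) (suc b * suc a)
  refine (i , matching) = i , refineMatching {k = suc b} {suc a} {Mono r′ χ′ i} {Mono r χ i} (inner-χ′ i) matching

evenMatching : ∀ k → EvenMatching (suc k)
evenMatching k = subst EvenMatching (sym isFactorisation) (proj₂ (go factors factorsPrime))
  where
  open PrimeFactorisation (factorise (suc k))
  -- The first component is carried along because evenMatching-* needs both factors to be nonzero.
  go : ∀ ps → All Prime ps → 1 ≤ product ps × EvenMatching (product ps)
  go []             []               = s≤s z≤n , evenMatching-1
  go (zero  ∷ ps)   (isPrime ∷ _)    = contradiction isPrime ¬prime[0]
  go (suc b ∷ ps)   (isPrime ∷ prs)  with product ps | go ps prs
  ... | suc a | _ , match = s≤s z≤n , evenMatching-* {a} {b} match (evenMatching-prime isPrime)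

-- Unequal matching sizes

∑-decAt : ∀ {t} (m : Fin t → ℕ) j → m j ≢ 0 → suc (∑ t (decAt m j)) ≡ ∑ t m
∑-decAt m zero mj≢0 with m zero
... | zero  = contradiction refl mj≢0
... | suc _ = refl
∑-decAt {suc t} m (suc j) mj≢0 = trans (sym (ℕ.+-suc (m zero) _))
  (cong (m zero +_) (trans (cong suc (∑-cong t tail)) (∑-decAt (m ∘ suc) j mj≢0)))
  where
  tail : ∀ i → decAt m (suc j) (suc i) ≡ decAt (m ∘ suc) j i
  tail i with i Fin.≟ j
  ... | yes _ = refl
  ... | no _  = refl

restrictMatching : ∀ {n k l} {P : Subset n → Set} → l ≤ k → Matching P k → Matching P l
restrictMatching l≤k (f , good , disjoint) =
  (λ a → f (inject≤ a l≤k)) , (λ a → good (inject≤ a l≤k)) ,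
  λ a b a≢b → disjoint _ _ (a≢b ∘ Fin.inject≤-injective l≤k l≤k a b)

decAt-≤ : ∀ {t} (m : Fin t → ℕ) j i → decAt m j i ≤ m i
decAt-≤ m j i with i Fin.≟ j
... | yes _ = ℕ.m∸n≤m (m i) 1
... | no _  = ℕ.≤-refl

decAt-≡ : ∀ {t} (m : Fin t → ℕ) j → decAt m j j ≡ m j ∸ 1
decAt-≡ m j with j Fin.≟ j
... | yes _  = refl
... | no j≢j = contradiction refl j≢j

decAt-≢ : ∀ {t} (m : Fin t → ℕ) {j i} → i ≢ j → decAt m j i ≡ m i
decAt-≢ m {j} {i} i≢j with i Fin.≟ j
... | yes i≡j = contradiction i≡j i≢j
... | no _    = refl

-- Give colour j to all sets through one new point: a matching contains at most one of them.
removePoint : ∀ {n r t m} j → MatchingProp (suc n) r t m → MatchingProp n r t (decAt m j)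
removePoint {n} {r} {t} {m} j prop χ = drop (prop χ⁺)
  where
  χ⁺ : Subset (suc n) → Fin t
  χ⁺ (b ∷ S) = if b then j else χ S
  old : ∀ {i} S → Vec.head S ≢ true → Mono r χ⁺ i S → Mono r χ i (Vec.tail S)
  old (true ∷ S)  ≢true _    = contradiction refl ≢true
  old (false ∷ S) _     good = good
  disjoint-tail : ∀ (A B : Subset (suc n)) → Disjoint A B → Disjoint (Vec.tail A) (Vec.tail B)
  disjoint-tail (_ ∷ A) (_ ∷ B) eq = ∷-injectiveʳ eq
  disjoint-head : ∀ (A B : Subset (suc n)) → Disjoint A B → Vec.head A ≡ true → Vec.head B ≢ true
  disjoint-head (true ∷ A) (true ∷ B) eq _ _ = contradiction (∷-injectiveˡ eq) λ ()
  new-colour : ∀ S → Vec.head S ≡ true → χ⁺ S ≡ j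
  new-colour (true ∷ S) _ = refl
  remove : ∀ {i k} (M : Matching (Mono r χ⁺ i) k) a → Vec.head (proj₁ M a) ≡ true →
           Matching (Mono r χ i) (k ∸ 1)
  remove {k = suc k} (f , good , disjoint) a new =
    (λ b → Vec.tail (f (punchIn a b))) ,
    (λ b → old (f (punchIn a b))
      (disjoint-head (f a) _ (disjoint a _ (Fin.punchInᵢ≢i a b ∘ sym)) new) (good _)) ,
    λ b c b≢c → disjoint-tail (f (punchIn a b)) (f (punchIn a c)) (disjoint _ _ (b≢c ∘ Fin.punchIn-injective a b c))
  drop : (∃ λ i → Matching (Mono r χ⁺ i) (m i)) →
         ∃ λ i → Matching (Mono r χ i) (decAt m j i)
  drop (i , f , good , disjoint) with Fin.any? (λ a → Vec.head (f a) Bool.≟ true)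
  ... | no none = i , restrictMatching {P = Mono r χ i} (decAt-≤ m j i)
    (Vec.tail ∘ f , (λ a → old (f a) (λ new → none (a , new)) (good a)) ,
     λ a b a≢b → disjoint-tail (f a) (f b) (disjoint a b a≢b))
  -- Comparing the two colours of `f a` identifies `i` with `j`, the index that `decAt` lowers.
  ... | yes (a , new) with trans (sym (new-colour (f a) new)) (proj₂ (good a))
  ...   | refl = j , subst (Matching (Mono r χ j)) (sym (decAt-≡ m j)) (remove (f , good , disjoint) a new)

-- Each removed point lowers by one a size that still exceeds its target; the equation of sums
-- guarantees such a size while points remain to be removed.
removePoints : ∀ e {n r t m m′} → (∀ i → m i ≤ m′ i) → ∑ t m′ ≡ e + ∑ t m →
               MatchingProp (e + n) r t m′ → MatchingProp n r t m
removePoints zero {t = t} m≤m′ sums prop χ with prop χ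
... | i , matching = i , restrictMatching {P = Mono _ χ i} (m≤m′ i) matching
removePoints (suc e) {t = t} {m} {m′} m≤m′ sums prop with Fin.any? (λ j → m j ℕ.<? m′ j)
... | no none = contradiction
  (ℕ.≤-trans (ℕ.≤-reflexive (sym sums)) (∑-mono t λ i → ℕ.≮⇒≥ λ lt → none (i , lt)))
  (ℕ.<⇒≱ (s≤s (ℕ.m≤n+m (∑ t m) e)))
... | yes (j , lt) = removePoints e below
  (suc-injective (trans (∑-decAt m′ j (ℕ.m<n⇒n≢0 lt)) sums)) (removePoint j prop)
  where
  below : ∀ i → m i ≤ decAt m′ j i
  below i with i Fin.≟ j
  ... | yes refl = ℕ.∸-monoˡ-≤ 1 lt
  ... | no _     = m≤m′ i

-- With all sizes raised to `m zero`, the even case asks for `e` more points, where `e` is the total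
-- excess of `m zero` over the `m j`. These points are then removed.
unevenMatching : ∀ u r (m : Fin (suc u) → ℕ) → (∀ j → 1 ≤ m j) → (∀ j → m j ≤ m zero) →
                 MatchingProp (m zero * r + ∑ u (λ j → m (suc j) ∸ 1)) r (suc u) m
unevenMatching u r m m≥1 m≤ with m zero in m₀ | m≥1 zero
... | suc k | _ = removePoints e bounded totals (evenMatching k u r _ points)
  where
  c : ℕ
  c = ∑ u (λ j → m (suc j) ∸ 1)
  e = u * k ∸ c
  bounded : ∀ i → m i ≤ suc k
  bounded = m≤
  c≤uk : c ≤ u * k
  c≤uk = ∑-bound u k λ j → ℕ.∸-monoˡ-≤ 1 (m≤ (suc j))
  e+c : e + c ≡ u * k
  e+c = ℕ.m∸n+n≡m c≤uk
  points : e + (suc k * r + c) ≡ suc k * r + u * k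
  points = trans (solve 3 (λ e x c → e :+ (x :+ c) := x :+ (e :+ c)) refl e (suc k * r) c) (cong (suc k * r +_) e+c)
    where open ℕSolver using (solve; _:+_; _:=_)
  ∑-suc : ∑ u (m ∘ suc) ≡ u + c
  ∑-suc = begin
    ∑ u (m ∘ suc)                            ≡⟨ ∑-cong u (λ j → sym (ℕ.m+[n∸m]≡n (m≥1 (suc j)))) ⟩
    ∑ u (λ j → 1 + (m (suc j) ∸ 1))          ≡⟨ ∑-+ u (λ _ → 1) (λ j → m (suc j) ∸ 1) ⟩
    ∑ u (λ _ → 1) + c                        ≡⟨ cong (_+ c) (trans (∑-const u 1) (ℕ.*-identityʳ u)) ⟩
    u + c                                    ∎
    where open ≡-Reasoning
  totals : ∑ (suc u) (λ _ → suc k) ≡ e + ∑ (suc u) m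
  totals = begin
    suc k + ∑ u (λ _ → suc k)     ≡⟨ cong (suc k +_) (trans (∑-const u (suc k)) (ℕ.*-suc u k)) ⟩
    suc k + (u + u * k)           ≡⟨ cong (λ z → suc k + (u + z)) e+c ⟨
    suc k + (u + (e + c))         ≡⟨ solve 4 (λ k u e c → k :+ (u :+ (e :+ c)) := e :+ (k :+ (u :+ c))) refl (suc k) u e c ⟩
    e + (suc k + (u + c))         ≡⟨ cong (e +_) (cong₂ _+_ (sym m₀) (sym ∑-suc)) ⟩
    e + ∑ (suc u) m               ∎
    where
    open ≡-Reasoning
    open ℕSolver using (solve; _:+_; _:=_)

-- Cliques in Kneser graphs

-- Injectivity comes from disjointness: two equal disjoint sets are empty, against `1 ≤ r`.
kneserClique : ∀ {n t r k} {c : Subset n → Subset n → Fin t} {i} → 1 ≤ r → (f : Fin k → Subset n) →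
               (∀ a → ∣ f a ∣ ≡ r) → (∀ a b → a ≢ b → Disjoint (f a) (f b) × c (f a) (f b) ≡ i) →
               KneserMonoClique r c i k
kneserClique {n} {r = r} 1≤r f sizes edges = f , injective , sizes , edges
  where
  injective : ∀ {a b} → f a ≡ f b → a ≡ b
  injective {a} {b} fa≡fb with a Fin.≟ b
  ... | yes a≡b = a≡b
  ... | no a≢b  = contradiction (subst (1 ≤_) r≡0 1≤r) λ ()
    where
    fa≡∅ : f a ≡ ⊥
    fa≡∅ = trans (sym (∩-idem (f a))) (trans (cong (f a ∩_) fa≡fb) (proj₁ (edges a b a≢b)))
    r≡0 : r ≡ 0
    r≡0 = trans (sym (sizes a)) (trans (cong ∣_∣ fa≡∅) (∣⊥∣≡0 n))

consClique : ∀ {n t r k} {c : Subset n → Subset n → Fin t} {i} → 1 ≤ r → SymColouring (Subset n) t c →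
             (A : Subset n) → ∣ A ∣ ≡ r → (M : KneserMonoClique r c i k) →
             (∀ a → Disjoint A (proj₁ M a) × c A (proj₁ M a) ≡ i) → KneserMonoClique r c i (suc k)
consClique {n} {r = r} {c = c} {i} 1≤r sym-c A ∣A∣≡r (f , _ , sizes , edges) joined =
  kneserClique {c = c} 1≤r f⁺ sizes⁺ edges⁺
  where
  f⁺ : Fin _ → Subset n
  f⁺ zero    = A
  f⁺ (suc a) = f a
  sizes⁺ : ∀ a → ∣ f⁺ a ∣ ≡ r
  sizes⁺ zero    = ∣A∣≡r
  sizes⁺ (suc a) = sizes a
  edges⁺ : ∀ a b → a ≢ b → Disjoint (f⁺ a) (f⁺ b) × c (f⁺ a) (f⁺ b) ≡ i
  edges⁺ zero    zero    0≢0 = contradiction refl 0≢0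
  edges⁺ zero    (suc b) _   = joined b
  edges⁺ (suc a) zero    _   = Disjoint-sym {A = A} (proj₁ (joined a)) , trans (sym-c (f a) A) (proj₂ (joined a))
  edges⁺ (suc a) (suc b) a≢b = edges a b (a≢b ∘ cong suc)

-- No nonempty clique fits on zero vertices. The bound makes every `m j ∸ 1` a true subtraction.
RamseyProp⇒1≤ : ∀ {t s n} → (∀ i → 1 ≤ s i) → RamseyProp (suc t) s n → 1 ≤ n
RamseyProp⇒1≤ {n = suc n} s≥1 prop = s≤s z≤n
RamseyProp⇒1≤ {n = zero}  s≥1 prop with prop (λ _ _ → zero) (λ _ _ → refl)
... | i , f , _ = contradiction (f (fromℕ< (s≥1 i))) λ ()

theorem5p1 : (u : ℕ) → 1 ≤ u → (s : Fin (suc u) → ℕ) → (∀ i → 3 ≤ s i) →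
    (m : Fin (suc u) → ℕ) → (∀ i → IsRamseyNumber (suc u) (decAt s i) (m i)) →
    (∀ j → m j ≤ m zero) →
    (r : ℕ) → 1 ≤ r →
    KneserRamseyLE r (suc u) s ((m zero + 1) * r + ∑ u (λ j → m (suc j) ∸ 1))
theorem5p1 u _ s s≥3 m ramsey m≤ r 1≤r = n , ℕ.≤-refl , clique
  where
  N = m zero * r + ∑ u (λ j → m (suc j) ∸ 1)
  n = (m zero + 1) * r + ∑ u (λ j → m (suc j) ∸ 1)
  n≡r+N : n ≡ r + N
  n≡r+N = solve 3 (λ k r c → (k :+ con 1) :* r :+ c := r :+ (k :* r :+ c)) refl (m zero) r (∑ u (λ j → m (suc j) ∸ 1))
    where open ℕSolver using (solve; _:+_; _:*_; _:=_; con)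
  decAt≥1 : ∀ i j → 1 ≤ decAt s i j
  decAt≥1 i j with j Fin.≟ i
  ... | yes _ = ℕ.∸-monoˡ-≤ 1 (ℕ.≤-trans (s≤s (s≤s z≤n)) (s≥3 j))
  ... | no _  = ℕ.≤-trans (s≤s z≤n) (s≥3 j)
  clique : KneserRamseyProp r (suc u) s n
  clique c sym-c with subsetOfSize r ⊤ (subst (r ≤_) (trans (sym n≡r+N) (sym (∣⊤∣≡n n))) (ℕ.m≤m+n r N))
  ... | A , _ , ∣A∣≡r with matchingInside (∁ A)
        (subst (λ N → MatchingProp N r (suc u) m) (sym ∣∁A∣≡N)
          (unevenMatching u r m (λ j → RamseyProp⇒1≤ (decAt≥1 j) (proj₁ (ramsey j))) m≤)) (c A)
    where
    ∣∁A∣≡N : ∣ ∁ A ∣ ≡ N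
    ∣∁A∣≡N = trans (∣∁p∣≡n∸∣p∣ A) (trans (cong₂ _∸_ n≡r+N ∣A∣≡r) (ℕ.m+n∸m≡n r N))
  -- The matching has `m i` members, so `c` restricted to it colours a complete graph on `m i`
  -- vertices; the clique found falls short of `s j` only when `j` is `i`.
  ... | i , f , good , disjoint with proj₁ (ramsey i) (λ a b → c (f a) (f b)) (λ a b → sym-c (f a) (f b))
  ... | j , g , g-injective , mono = extend (j Fin.≟ i)
    where
    joined : ∀ a → Disjoint A (f a) × c A (f a) ≡ i
    joined a = Disjoint-⊆ ⊆-refl (proj₁ (good a)) (∩-inverseʳ A) , proj₂ (proj₂ (good a))
    base : KneserMonoClique r c j (decAt s i j)
    base = kneserClique {c = c} 1≤r (f ∘ g) (λ a → proj₁ (proj₂ (good (g a))))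
      λ a b a≢b → disjoint _ _ (a≢b ∘ g-injective) , mono a b a≢b
    extend : Dec (j ≡ i) → ∃ λ i → KneserMonoClique r c i (s i)
    extend (no j≢i)   = j , subst (KneserMonoClique r c j) (decAt-≢ s j≢i) base
    -- Adding `A` restores the vertex that `decAt` took off; `s j` is positive, so `1 + (s j ∸ 1)`
    -- is `s j`.
    extend (yes refl) = j , subst (KneserMonoClique r c j)
      (trans (cong suc (decAt-≡ s j)) (ℕ.m+[n∸m]≡n (ℕ.≤-trans (s≤s z≤n) (s≥3 j))))
      (consClique 1≤r sym-c A ∣A∣≡r base λ a → joined (g a))
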